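{- Let $\boldsymbol{a}=(a_1,\dots,a_N)$ be a sequence of positive integers with $\gcd(\boldsymbol{a})=1$, let $f>1$ be an integer dividing at least one $a_i$, and let $n=n(f\mid\boldsymbol{a})$, $\mathcal{P}_f$, $\Phi_f$, $\widehat{\Phi}_f$, $\mathcal{W}_f(t;\boldsymbol{a},\zeta)$, $M_m(x)$ and the Sylvester wave $W_f(t;\boldsymbol{a})$ be as defined in the context. For each $0\le m\le n-1$, write $$M_m(x)\,\widehat{\Phi}_f(x)\,\Phi_f'(x)\equiv\sum_{i=0}^{f-1}c_{m,i}\,x^i \pmod{\langle x^f-1\rangle}.$$ Then for every nonnegative integer $t$ and every $0\le m\le n-1$, $$[s^{\,n-1-m}]\sum_{\zeta\in\mathcal{P}_f}\mathcal{W}_f(t;\boldsymbol{a},\zeta)=c_{m,\hat t-1},$$ where $\hat t\in\{1,\dots,f\}$ is determined by $\hat t\equiv t\pmod f$. Furthermore, $W_f(t;\boldsymbol{a})=[P_1(t),\dots,P_f(t)]$, where for $1\le i\le f$ $$P_i(t)=\sum_{m=0}^{n-1}\frac{(-1)^{n+m+1}}{m!\,\prod_{k:\,f\mid a_k}a_k}\,c_{m,i-1}\,t^m .$$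
   Context: $\mathcal{P}_f$ is the set of primitive $f$-th roots of unity in $\mathbb{C}$; $\Phi_f(x)=\prod_{\zeta\in\mathcal{P}_f}(x-\zeta)$ is the $f$-th cyclotomic polynomial; $\widehat{\Phi}_f(x)=\frac{x^f-1}{\Phi_f(x)}$. The number $n(f\mid\boldsymbol{a})=\#\{i: f\mid a_i\}$. $[s^k]G(s)$ denotes the coefficient of $s^k$ in the power series $G(s)$. The Sylvester wave is $$W_f(t;\boldsymbol{a})=-\operatorname{Res}_{s=0}\sum_{\zeta\in\mathcal{P}_f}\frac{\zeta^{ -t}e^{ -ts}}{\prod_{i=1}^N(1-\zeta^{a_i}e^{a_is})},$$ where $\operatorname{Res}_{s=0}$ is the coefficient of $s^{ -1}$ in the Laurent expansion at $s=0$. The notation $F(t)=[P_1(t),\dots,P_f(t)]$, with $P_i$ polynomials in $t$, means $F(t)=P_i(t)$ whenever $t\equiv i\pmod f$, $1\le i\le f$ (so $t\equiv0$ is treated as $t\equiv f$). For $P(x)\in\mathbb{Q}[x]$, $\langle P(x)\rangle_R$ denotes the unique polynomial of degree at most $\varphi(f)-1$ congruent to $P(x)$ modulo $\Phi_f(x)$, where $\varphi$ is Euler's totient function. Let $\theta_f(x)=\sum_{i=0}^{f-1}x^i$. For each $i$ with $f\nmid a_i$ put $$v_i(x)=\Big\langle -\tfrac1f\,x^{a_i}\,\theta_f'(x^{a_i})\Big\rangle_R$$ (here $\theta_f'(x^{a_i})$ is the derivative $\theta_f'$ evaluated at $x^{a_i}$); for $\zeta\in\mathcal{P}_f$ one has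 $v_i(\zeta)=\frac1{1-\zeta^{a_i}}$. Let $$g(s)=\frac{s}{e^s-1},\qquad g(s,y)=\frac{1}{1-y(e^s-1)},$$ regarded as power series in $s$. Define, for $\zeta\in\mathcal{P}_f$, $$\mathcal{W}_f(t;\boldsymbol{a},\zeta)=\zeta^{ -t}\prod_{i:\,f\nmid a_i}v_i(\zeta)\prod_{i:\,f\mid a_i}g(a_is)\prod_{i:\,f\nmid a_i}g(a_is,\,v_i(\zeta)-1).$$ For $0\le k\le n-1$ let $\widehat{M}_k(x)\in\mathbb{Q}[x]$ be polynomials such that for all $\zeta\in\mathcal{P}_f$ $$\prod_{i:\,f\mid a_i}g(a_is)\prod_{i:\,f\nmid a_i}g(a_is,\,v_i(\zeta)-1)\equiv\sum_{k=0}^{n-1}\widehat{M}_k(\zeta)s^k\pmod{\langle s^n\rangle},$$ and for $0\le m\le n-1$ put $$M_m(x)=\Big\langle \widehat{M}_{n-1-m}(x)\prod_{i:\,f\nmid a_i}v_i(x)\Big\rangle_R .$$ -}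

module Defs where

open import Level using (_⊔_)
open import Algebra.Apartness.Bundles using (HeytingField; HeytingCommutativeRing)
open import Algebra.Bundles using (CommutativeRing; Semiring)
import Algebra.Definitions.RawSemiring as RawSemiringDefs
import Algebra.Properties.Ring as RingProperties
import Algebra.Properties.Semiring.Exp as ExpProperties
import Algebra.Properties.Monoid.Mult as MultProperties
import Algebra.Apartness.Properties.HeytingCommutativeRing as ApartProperties
import Relation.Binary.Reasoning.Setoid as SetoidReasoning
open import Data.Nat.Base as ℕ using (ℕ; zero; suc; pred; z≤n; s≤s; NonZero; NonTrivial; _!)
import Data.Nat.Properties as ℕ
open import Data.Nat.Divisibility as ℕ using (_∣_; _∤_; _∣?_; divides)
open import Data.Nat.DivMod as ℕ using (_/_; _%_)
open import Data.Nat.GCD using (gcd)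
import Data.Nat.ListAction as ℕ
import Data.Nat.ListAction.Properties as ℕ
open import Data.Integer.Base as ℤ using (ℤ; +_; -[1+_])
import Data.Integer.Divisibility as ℤ
open import Data.Rational.Base as ℚ using (ℚ)
open import Data.Fin.Base as Fin using (Fin; toℕ)
open import Data.List.Base as List using (List; []; _∷_; filter; allFin; length)
open import Data.List.Relation.Unary.Any using (Any)
open import Data.List.Relation.Unary.All using (All; universal)
import Data.List.Relation.Unary.All.Properties as All
open import Data.List.Relation.Unary.AllPairs using (AllPairs)
open import Data.Vec.Base as Vec using (Vec; []; _∷_)
open import Data.Vec.Functional as Vector using (Vector)
open import Data.Product.Base using (∃; _×_; _,_; proj₁; proj₂)
open import Data.Sum.Base using (_⊎_; inj₁; inj₂)
open import Function.Base using (_∘_)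
open import Relation.Nullary using (¬_; Dec; yes; no; ¬?)
open import Relation.Binary.PropositionalEquality.Core as ≡ using (_≡_; _≢_)

gcdᵥ : ∀ {N} → Vector ℕ N → ℕ
gcdᵥ = Vector.foldr gcd 0

infix 4 _≡_[mod_]
_≡_[mod_] : ℤ → ℤ → ℕ → Set
t ≡ i [mod f ] = (+ f) ℤ.∣ (t ℤ.- i)

CharZero : ∀ {c ℓ₁ ℓ₂} → HeytingField c ℓ₁ ℓ₂ → Set ℓ₂
CharZero K = ∀ n → (suc n ×ₖ 1#) # 0#
  where
  open HeytingField K
  open CommutativeRing (HeytingCommutativeRing.commutativeRing heytingCommutativeRing)
    using (semiring)
  open RawSemiringDefs (Semiring.rawSemiring semiring) renaming (_×_ to _×ₖ_)

-- K plays the role of ℂ: any field of characteristic zero.  The apartness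
-- _#_ is read as "≠", and x # y is what makes x − y invertible.

module Over {c ℓ₁ ℓ₂} (K : HeytingField c ℓ₁ ℓ₂) (char0 : CharZero K) where

  open HeytingField K public
    using (Carrier; _≈_; _#_; _+_; _*_; -_; _-_; 0#; 1#)
  open HeytingField K
    using ( heytingCommutativeRing; setoid; refl; sym; trans; #-sym
          ; #⇒invertible; invertible⇒#
          ; +-cong; +-congˡ; +-congʳ; +-identityˡ; +-identityʳ; -‿cong; -‿inverseʳ; -‿inverseˡ
          ; +-assoc; +-comm
          ; *-cong; *-congˡ; *-congʳ; *-identityˡ; *-identityʳ; *-comm; *-assoc
          ; zeroˡ; zeroʳ; distribˡ; distribʳ)
  private
    commRing : CommutativeRing c ℓ₁
    commRing = HeytingCommutativeRing.commutativeRing heytingCommutativeRing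
    open CommutativeRing commRing
      using (ring; semiring; *-monoid)
    open RingProperties ring using (-0#≈0#; -‿distribʳ-*; -‿distribˡ-*)
    module Exp = ExpProperties semiring
    module MultMonoid = MultProperties *-monoid
    module Apart = ApartProperties heytingCommutativeRing
  open RawSemiringDefs (Semiring.rawSemiring semiring) public using (_^_; sum)
  open RawSemiringDefs (Semiring.rawSemiring semiring) using () renaming (_×_ to _×ₖ_)

  inv : ∀ {x} → x # 0# → Carrier
  inv x#0 = proj₁ (#⇒invertible x#0)

  *-inv : ∀ {x} (x#0 : x # 0#) → x * inv x#0 ≈ 1#
  *-inv x#0 = trans (*-congʳ (sym (Apart.x-0≈x _)))
                    (proj₂ (proj₂ (#⇒invertible x#0)))

  *≈1⇒#0 : ∀ {x y} → x * y ≈ 1# → x # 0#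
  *≈1⇒#0 {x} {y} xy≈1 =
    Apart.invertibleʳ⇒# (y , trans (*-congʳ (Apart.x-0≈x x)) xy≈1)

  fromℕ : ℕ → Carrier
  fromℕ n = n ×ₖ 1#

  fromℕ#0 : ∀ n .{{_ : NonZero n}} → fromℕ n # 0#
  fromℕ#0 (suc n) = char0 n

  1/ℕ : ∀ n .{{_ : NonZero n}} → Carrier
  1/ℕ n = inv (fromℕ#0 n)

  1/ℕ#0 : ∀ n .{{_ : NonZero n}} → 1/ℕ n # 0#
  1/ℕ#0 n = *≈1⇒#0 (trans (*-comm _ _) (*-inv (fromℕ#0 n)))

  1/1≈1 : ∀ n .{{_ : NonZero n}} → n ≡ 1 → 1/ℕ n ≈ 1#
  1/1≈1 n ≡.refl =
    trans (sym (trans (*-congʳ (+-identityʳ 1#)) (*-identityˡ _)))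
          (*-inv (fromℕ#0 1))

  fromℤ : ℤ → Carrier
  fromℤ (+ n)    = fromℕ n
  fromℤ -[1+ n ] = - fromℕ (suc n)

  fromℚ : ℚ → Carrier
  fromℚ q = fromℤ (ℚ.↥ q) * 1/ℕ (ℚ.↧ₙ q)

  ∏[_] : ∀ {ℓ} {I : Set ℓ} → List I → (I → Carrier) → Carrier
  ∏[ is ] h = List.foldr _*_ 1# (List.map h is)

  -- Coefficients, constant term first; trailing zeros are allowed.
  Poly : Set c
  Poly = List Carrier

  coeff : Poly → ℕ → Carrier
  coeff []      _       = 0#
  coeff (x ∷ p) zero    = x
  coeff (x ∷ p) (suc k) = coeff p k

  infix 4 _≈ₚ_
  _≈ₚ_ : Poly → Poly → Set ℓ₁
  p ≈ₚ q = ∀ k → coeff p k ≈ coeff q k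

  infixl 6 _+ₚ_
  _+ₚ_ : Poly → Poly → Poly
  []      +ₚ q       = q
  (x ∷ p) +ₚ []      = x ∷ p
  (x ∷ p) +ₚ (y ∷ q) = (x + y) ∷ (p +ₚ q)

  infixr 7 _·ₚ_
  _·ₚ_ : Carrier → Poly → Poly
  x ·ₚ p = List.map (x *_) p

  infixl 7 _*ₚ_
  _*ₚ_ : Poly → Poly → Poly
  []      *ₚ q = []
  (x ∷ p) *ₚ q = x ·ₚ q +ₚ (0# ∷ p *ₚ q)

  X^ : ℕ → Poly
  X^ zero    = 1# ∷ []
  X^ (suc k) = 0# ∷ X^ k

  X^_−1 : ℕ → Poly
  X^ f −1 = X^ f +ₚ (- 1# ∷ [])

  eval : Poly → Carrier → Carrier
  eval []      y = 0#
  eval (x ∷ p) y = x + y * eval p y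

  infixl 8 _∘ₚ_
  _∘ₚ_ : Poly → Poly → Poly
  []      ∘ₚ q = []
  (x ∷ p) ∘ₚ q = (x ∷ []) +ₚ q *ₚ (p ∘ₚ q)

  -- (x + X p)′ = p + X p′
  infix 9 _′
  _′ : Poly → Poly
  []      ′ = []
  (x ∷ p) ′ = p +ₚ (0# ∷ p ′)

  ∏ₚ[_] : ∀ {ℓ} {I : Set ℓ} → List I → (I → Poly) → Poly
  ∏ₚ[ is ] h = List.foldr _*ₚ_ (1# ∷ []) (List.map h is)

  infix 4 _≡ₚ_[mod_]
  _≡ₚ_[mod_] : Poly → Poly → Poly → Set (c ⊔ ℓ₁)
  p ≡ₚ r [mod d ] = ∃ λ q → p ≈ₚ r +ₚ q *ₚ d

  record Monic (d : Poly) (n : ℕ) : Set ℓ₁ where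
    field
      leading : coeff d n ≈ 1#
      bounded : ∀ k → n ℕ.< k → coeff d k ≈ 0#

  -- Quotient and remainder on division by d, for d monic of degree n.
  -- If p = q d + r then x + X p = (X q + l) d + (x + X r − l d), where l is
  -- the coefficient of Xⁿ in x + X r.
  divMod : Poly → ℕ → Poly → Poly × Poly
  divMod d n []      = [] , []
  divMod d n (x ∷ p) =
    let q , r = divMod d n p
        l     = coeff (x ∷ r) n
    in  (l ∷ q) , (x ∷ r) +ₚ (- l) ·ₚ d

  private
    coeff-+ : ∀ p q k → coeff (p +ₚ q) k ≈ coeff p k + coeff q k
    coeff-+ []      q       k       = sym (+-identityˡ _)
    coeff-+ (x ∷ p) []      k       = sym (+-identityʳ _)
    coeff-+ (x ∷ p) (y ∷ q) zero    = refl
    coeff-+ (x ∷ p) (y ∷ q) (suc k) = coeff-+ p q k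

    coeff-· : ∀ x p k → coeff (x ·ₚ p) k ≈ x * coeff p k
    coeff-· x []      k       = sym (zeroʳ x)
    coeff-· x (y ∷ p) zero    = refl
    coeff-· x (y ∷ p) (suc k) = coeff-· x p k

  divMod-correct : ∀ d n p → let q , r = divMod d n p in p ≈ₚ r +ₚ q *ₚ d
  divMod-correct d n []      k = refl
  divMod-correct d n (x ∷ p) k = sym (begin
    coeff (((x ∷ r) +ₚ (- l) ·ₚ d) +ₚ (l ·ₚ d +ₚ (0# ∷ q *ₚ d))) k
      ≈⟨ coeff-+ ((x ∷ r) +ₚ (- l) ·ₚ d) (l ·ₚ d +ₚ (0# ∷ q *ₚ d)) k ⟩
    coeff ((x ∷ r) +ₚ (- l) ·ₚ d) k + coeff (l ·ₚ d +ₚ (0# ∷ q *ₚ d)) k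
      ≈⟨ +-cong (coeff-+ (x ∷ r) ((- l) ·ₚ d) k) (coeff-+ (l ·ₚ d) (0# ∷ q *ₚ d) k) ⟩
    (R + coeff ((- l) ·ₚ d) k) + (coeff (l ·ₚ d) k + Q)
      ≈⟨ +-cong (+-congˡ (coeff-· (- l) d k)) (+-congʳ (coeff-· l d k)) ⟩
    (R + - l * D) + (l * D + Q)
      ≈⟨ +-assoc R _ _ ⟩
    R + (- l * D + (l * D + Q))
      ≈⟨ +-congˡ (+-assoc _ _ Q) ⟨
    R + ((- l * D + l * D) + Q)
      ≈⟨ +-congˡ (+-congʳ (trans (+-congʳ (sym (-‿distribˡ-* l D))) (-‿inverseˡ _))) ⟩
    R + (0# + Q)
      ≈⟨ +-congˡ (+-identityˡ Q) ⟩
    R + Q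
      ≈⟨ step k ⟩
    coeff (x ∷ p) k ∎)
    where
    open SetoidReasoning setoid
    q = proj₁ (divMod d n p)
    r = proj₂ (divMod d n p)
    l = coeff (x ∷ r) n
    R = coeff (x ∷ r) k
    D = coeff d k
    Q = coeff (0# ∷ q *ₚ d) k
    step : ∀ k → coeff (x ∷ r) k + coeff (0# ∷ q *ₚ d) k ≈ coeff (x ∷ p) k
    step zero    = +-identityʳ x
    step (suc k) = trans (sym (coeff-+ r (q *ₚ d) k)) (sym (divMod-correct d n p k))

  divMod-bounded : ∀ {d n} → Monic d n → ∀ p k → n ℕ.≤ k →
                   coeff (proj₂ (divMod d n p)) k ≈ 0#
  divMod-bounded         monic []      k n≤k = refl
  divMod-bounded {d} {n} monic (x ∷ p) k n≤k = begin
    coeff ((x ∷ r) +ₚ (- l) ·ₚ d) k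
      ≈⟨ coeff-+ (x ∷ r) ((- l) ·ₚ d) k ⟩
    coeff (x ∷ r) k + coeff ((- l) ·ₚ d) k
      ≈⟨ +-congˡ (coeff-· (- l) d k) ⟩
    coeff (x ∷ r) k + - l * coeff d k
      ≈⟨ step k (ℕ.m≤n⇒m<n∨m≡n n≤k) ⟩
    0# ∎
    where
    open SetoidReasoning setoid
    r = proj₂ (divMod d n p)
    l = coeff (x ∷ r) n
    step : ∀ k → n ℕ.< k ⊎ n ≡ k → coeff (x ∷ r) k + - l * coeff d k ≈ 0#
    step k (inj₂ ≡.refl) =
      trans (+-congˡ (trans (*-congˡ (Monic.leading monic)) (*-identityʳ _))) (-‿inverseʳ l)
    step (suc k) (inj₁ n<k) =
      trans (+-cong (divMod-bounded monic p k (ℕ.≤-pred n<k))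
                    (trans (*-congˡ (Monic.bounded monic (suc k) n<k)) (zeroʳ _)))
            (+-identityʳ 0#)

  Series : Set c
  Series = ℕ → Carrier

  0ₛ 1ₛ : Series
  0ₛ _       = 0#
  1ₛ zero    = 1#
  1ₛ (suc _) = 0#

  infixl 6 _+ₛ_ _-ₛ_
  _+ₛ_ _-ₛ_ : Series → Series → Series
  (F +ₛ G) k = F k + G k
  (F -ₛ G) k = F k - G k

  infixr 7 _·ₛ_
  _·ₛ_ : Carrier → Series → Series
  (x ·ₛ F) k = x * F k

  infixl 7 _*ₛ_
  _*ₛ_ : Series → Series → Series
  (F *ₛ G) k = sum {suc k} λ i → F (toℕ i) * G (k ℕ.∸ toℕ i)

  shift : ℕ → Series → Series
  shift zero    F k       = F k
  shift (suc d) F zero    = 0#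
  shift (suc d) F (suc k) = shift d F k

  ∑ₛ[_] : ∀ {ℓ} {I : Set ℓ} → List I → (I → Series) → Series
  ∑ₛ[ is ] h = List.foldr _+ₛ_ 0ₛ (List.map h is)

  ∏ₛ[_] : ∀ {ℓ} {I : Set ℓ} → List I → (I → Series) → Series
  ∏ₛ[ is ] h = List.foldr _*ₛ_ 1ₛ (List.map h is)

  -- F(xs)
  infixl 9 _⟨_s⟩
  _⟨_s⟩ : Series → Carrier → Series
  (F ⟨ x s⟩) k = x ^ k * F k

  module Reciprocal (F : Series) (F₀#0 : F 0 # 0#) where

    dot : ∀ {n} → Series → Vec Carrier n → Carrier
    dot G []       = 0#
    dot G (h ∷ hs) = G 0 * h + dot (G ∘ suc) hs

    -- the coefficients hₙ, …, h₀ of 1/F, from F₀ hₙ₊₁ + ∑_{j≤n} F_{j+1} hₙ₋ⱼ = 0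
    coefficients : ∀ n → Vec Carrier (suc n)
    coefficients zero    = inv F₀#0 ∷ []
    coefficients (suc n) =
      - (inv F₀#0 * dot (F ∘ suc) (coefficients n)) ∷ coefficients n

    recip : Series
    recip n = Vec.head (coefficients n)

    dot≈sum : ∀ G n → dot G (coefficients n) ≈ (G *ₛ recip) n
    dot≈sum G zero    = refl
    dot≈sum G (suc n) = +-congˡ (dot≈sum (G ∘ suc) n)

    *-recip : ∀ k → (F *ₛ recip) k ≈ 1ₛ k
    *-recip zero    = trans (+-identityʳ _) (*-inv F₀#0)
    *-recip (suc n) = begin
      F 0 * - (u * D) + (F′ *ₛ recip) n  ≈⟨ +-cong (sym (-‿distribʳ-* _ _)) (sym (dot≈sum F′ n)) ⟩
      - (F 0 * (u * D)) + D              ≈⟨ +-congʳ (-‿cong (*-assoc _ u D)) ⟨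
      - (F 0 * u * D) + D                ≈⟨ +-congʳ (-‿cong (*-congʳ (*-inv F₀#0))) ⟩
      - (1# * D) + D                     ≈⟨ +-congʳ (-‿cong (*-identityˡ D)) ⟩
      - D + D                            ≈⟨ -‿inverseˡ D ⟩
      0#                                 ∎
      where
      open SetoidReasoning setoid
      F′ = F ∘ suc
      u = inv F₀#0
      D = dot F′ (coefficients n)

  open Reciprocal public using (recip; *-recip)

  infix 4 _≈[<_]_
  _≈[<_]_ : Series → ℕ → Series → Set ℓ₁
  F ≈[< n ] G = ∀ k → k ℕ.< n → F k ≈ G k

  exp : Carrier → Series
  exp x k = x ^ k * 1/ℕ (k !) {{k ℕ.!≢0}}

  expm1 : Series
  expm1 = exp 1# -ₛ 1ₛ

  -- s^(-pole) · series
  record Laurent : Set c where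
    constructor s^-_·_
    field
      pole   : ℕ
      series : Series
  open Laurent public

  fromSeries : Series → Laurent
  fromSeries F = s^- 0 · F

  infixl 6 _+ₗ_
  _+ₗ_ : Laurent → Laurent → Laurent
  (s^- d · F) +ₗ (s^- e · G) = s^- (d ℕ.+ e) · (shift e F +ₛ shift d G)

  infixl 7 _*ₗ_
  _*ₗ_ : Laurent → Laurent → Laurent
  (s^- d · F) *ₗ (s^- e · G) = s^- (d ℕ.+ e) · (F *ₛ G)

  ∑ₗ[_] : ∀ {ℓ} {I : Set ℓ} → List I → (I → Laurent) → Laurent
  ∑ₗ[ is ] h = List.foldr _+ₗ_ (fromSeries 0ₛ) (List.map h is)

  ∏ₗ[_] : ∀ {ℓ} {I : Set ℓ} → List I → (I → Laurent) → Laurent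
  ∏ₗ[ is ] h = List.foldr _*ₗ_ (fromSeries 1ₛ) (List.map h is)

  Res : Laurent → Carrier
  Res (s^- zero  · F) = 0#
  Res (s^- suc d · F) = F d

  record HasOrder (F : Series) (d : ℕ) : Set (ℓ₁ ⊔ ℓ₂) where
    field
      below   : ∀ k → k ℕ.< d → F k ≈ 0#
      leading : F d # 0#

  1/ₗ : ∀ F {d} → HasOrder F d → Laurent
  1/ₗ F {d} ord =
    s^- d · recip (λ k → F (k ℕ.+ d)) (HasOrder.leading ord)

  private
    exp₀≈1 : ∀ x → exp x 0 ≈ 1#
    exp₀≈1 x = trans (*-identityˡ _) (1/1≈1 1 ≡.refl)

    x-x≈0 : ∀ {x y} → x ≈ y → x - y ≈ 0#
    x-x≈0 x≈y = trans (+-congʳ x≈y) (-‿inverseʳ _)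

    expm1₁#0 : expm1 1 # 0#
    expm1₁#0 = Apart.#-congʳ (sym e) Apart.1#0
      where
      open SetoidReasoning setoid
      e : expm1 1 ≈ 1#
      e = begin
        1# * 1# * 1/ℕ 1 - 0#  ≈⟨ Apart.x-0≈x _ ⟩
        1# * 1# * 1/ℕ 1       ≈⟨ *-cong (*-identityˡ 1#) (1/1≈1 1 ≡.refl) ⟩
        1# * 1#               ≈⟨ *-identityˡ 1# ⟩
        1#                    ∎

    1-y·expm1₀#0 : ∀ y → (1ₛ -ₛ y ·ₛ expm1) 0 # 0#
    1-y·expm1₀#0 y = Apart.#-congʳ (sym e) Apart.1#0
      where
      open SetoidReasoning setoid
      e : 1# - y * expm1 0 ≈ 1#
      e = begin
        1# - y * expm1 0  ≈⟨ +-congˡ (-‿cong (*-congˡ (x-x≈0 (exp₀≈1 1#)))) ⟩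
        1# - y * 0#       ≈⟨ +-congˡ (-‿cong (zeroʳ y)) ⟩
        1# - 0#           ≈⟨ Apart.x-0≈x 1# ⟩
        1#                ∎

  -- expm1 ∘ suc is (e^s − 1)/s
  g : Series
  g = recip (expm1 ∘ suc) expm1₁#0

  g[s,_] : Carrier → Series
  g[s, y ] = recip (1ₛ -ₛ y ·ₛ expm1) (1-y·expm1₀#0 y)

  record PrimitiveRoot (f : ℕ) : Set (c ⊔ ℓ₁ ⊔ ℓ₂) where
    field
      value     : Carrier
      isRoot    : value ^ f ≈ 1#
      minimal   : ∀ k → 0 ℕ.< k → k ℕ.< f → value ^ k # 1#
  open PrimitiveRoot public

  -- The set 𝒫_f, as a list without repetitions
  record PrimitiveRoots (f : ℕ) : Set (c ⊔ ℓ₁ ⊔ ℓ₂) where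
    field
      roots    : List (PrimitiveRoot f)
      distinct : AllPairs (λ ζ η → value ζ # value η) roots
      complete : ∀ (ζ : PrimitiveRoot f) → Any (λ η → value ζ ≈ value η) roots

  module _ {f : ℕ} .{{_ : NonTrivial f}} (ζ : PrimitiveRoot f) where
    private
      instance
        f≢0 : NonZero f
        f≢0 = ℕ.nonTrivial⇒nonZero f

      z = value ζ

    root#0 : z # 0#
    root#0 = *≈1⇒#0 {y = z ^ pred f}
      (trans (Exp.^-congʳ z (ℕ.suc-pred f)) (isRoot ζ))

    infixr 8 root^_
    root^_ : ℤ → Carrier
    root^ (+ n)    = z ^ n
    root^ -[1+ n ] = inv root#0 ^ suc n

    private
      1^ : ∀ n → 1# ^ n ≈ 1#
      1^ zero    = refl
      1^ (suc n) = trans (*-identityˡ _) (1^ n)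

      z^[kf] : ∀ k → z ^ (k ℕ.* f) ≈ 1#
      z^[kf] k = begin
        z ^ (k ℕ.* f)  ≡⟨ ≡.cong (z ^_) (ℕ.*-comm k f) ⟩
        z ^ (f ℕ.* k)  ≈⟨ Exp.^-assocʳ z f k ⟨
        (z ^ f) ^ k    ≈⟨ Exp.^-congˡ k (isRoot ζ) ⟩
        1# ^ k         ≈⟨ 1^ k ⟩
        1#             ∎
        where open SetoidReasoning setoid

      z^a≈1 : ∀ {a} → f ∣ a → z ^ a ≈ 1#
      z^a≈1 (divides k ≡.refl) = z^[kf] k

      z^a#1 : ∀ {a} → f ∤ a → z ^ a # 1#
      z^a#1 {a} f∤a = Apart.#-congʳ (sym e)
        (minimal ζ (a % f) (ℕ.n≢0⇒n>0 (f∤a ∘ ℕ.m%n≡0⇒n∣m a f)) (ℕ.m%n<n a f))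
        where
        open SetoidReasoning setoid
        e : z ^ a ≈ z ^ (a % f)
        e = begin
          z ^ a                                ≡⟨ ≡.cong (z ^_) (ℕ.m≡m%n+[m/n]*n a f) ⟩
          z ^ (a % f ℕ.+ a / f ℕ.* f)          ≈⟨ Exp.^-homo-* z (a % f) _ ⟩
          z ^ (a % f) * z ^ (a / f ℕ.* f)      ≈⟨ *-congˡ (z^[kf] (a / f)) ⟩
          z ^ (a % f) * 1#                     ≈⟨ *-identityʳ _ ⟩
          z ^ (a % f)                          ∎

      x#y⇒x-y#0 : ∀ {x y} → x # y → x - y # 0#
      x#y⇒x-y#0 x#y = *≈1⇒#0 (proj₂ (proj₂ (#⇒invertible x#y)))

      -#0 : ∀ {x} → x # 0# → 0# - x # 0#
      -#0 x#0 = x#y⇒x-y#0 (#-sym x#0)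

    -- 1 − ζ^a e^(as)
    factor : ℕ → Series
    factor a = 1ₛ -ₛ z ^ a ·ₛ exp (fromℕ a)

    factor-order : ℕ → ℕ
    factor-order a with f ∣? a
    ... | yes _ = 1
    ... | no  _ = 0

    private
      z^a*exp₀ : ∀ a → z ^ a * exp (fromℕ a) 0 ≈ z ^ a
      z^a*exp₀ a = trans (*-congˡ (exp₀≈1 (fromℕ a))) (*-identityʳ _)

    factor-hasOrder : ∀ a .{{_ : NonZero a}} → HasOrder (factor a) (factor-order a)
    factor-hasOrder a with f ∣? a
    ... | yes f∣a = record
      { below   = λ { zero _ → x-x≈0 (sym (trans (z^a*exp₀ a) (z^a≈1 f∣a)))
                    ; (suc _) (s≤s ()) }
      ; leading = -#0 (Apart.#-congʳ (sym e) (fromℕ#0 a))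
      }
      where
      open SetoidReasoning setoid
      A = fromℕ a
      e : z ^ a * exp A 1 ≈ A
      e = begin
        z ^ a * (A * 1# * 1/ℕ 1)  ≈⟨ *-cong (z^a≈1 f∣a) (*-cong (*-identityʳ A) (1/1≈1 1 ≡.refl)) ⟩
        1# * (A * 1#)             ≈⟨ *-identityˡ _ ⟩
        A * 1#                    ≈⟨ *-identityʳ A ⟩
        A                         ∎
    ... | no f∤a = record
      { below   = λ _ ()
      ; leading = x#y⇒x-y#0 (#-sym (Apart.#-congʳ (sym (z^a*exp₀ a)) (z^a#1 f∤a)))
      }

  module Cyclotomic {f : ℕ} .{{_ : NonTrivial f}} (𝒫 : PrimitiveRoots f) where

    private
      instance
        f≢0 : NonZero f
        f≢0 = ℕ.nonTrivial⇒nonZero f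

    open PrimitiveRoots 𝒫 public

    Φ : Poly
    Φ = ∏ₚ[ roots ] λ ζ → - value ζ ∷ 1# ∷ []

    -- φ(f), the number of primitive f-th roots of unity
    degΦ : ℕ
    degΦ = length roots

    Φ-monic : Monic Φ degΦ
    Φ-monic = go roots
      where
      linear : PrimitiveRoot f → Poly
      linear ζ = - value ζ ∷ 1# ∷ []
      coeff-linear-* : ∀ z p k →
        coeff ((z ∷ 1# ∷ []) *ₚ p) (suc k) ≈ z * coeff p (suc k) + coeff p k
      coeff-linear-* z p k = begin
        coeff (z ·ₚ p +ₚ (0# ∷ (1# ·ₚ p +ₚ (0# ∷ [])))) (suc k)
          ≈⟨ coeff-+ (z ·ₚ p) _ (suc k) ⟩
        coeff (z ·ₚ p) (suc k) + coeff (1# ·ₚ p +ₚ (0# ∷ [])) k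
          ≈⟨ +-cong (coeff-· z p (suc k)) (coeff-+ (1# ·ₚ p) _ k) ⟩
        z * coeff p (suc k) + (coeff (1# ·ₚ p) k + coeff (0# ∷ []) k)
          ≈⟨ +-congˡ (+-cong (trans (coeff-· 1# p k) (*-identityˡ _)) (coeff-0 k)) ⟩
        z * coeff p (suc k) + (coeff p k + 0#)
          ≈⟨ +-congˡ (+-identityʳ _) ⟩
        z * coeff p (suc k) + coeff p k ∎
        where
        open SetoidReasoning setoid
        coeff-0 : ∀ k → coeff (0# ∷ []) k ≈ 0#
        coeff-0 zero    = refl
        coeff-0 (suc k) = refl
      go : ∀ ζs → Monic (∏ₚ[ ζs ] linear) (length ζs)
      go [] = record { leading = refl ; bounded = λ { (suc k) _ → refl } }
      go (ζ ∷ ζs) = record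
        { leading = trans (coeff-linear-* _ p (length ζs))
            (trans (+-cong (trans (*-congˡ (bounded (suc (length ζs)) ℕ.≤-refl)) (zeroʳ _))
                           leading)
                   (+-identityˡ 1#))
        ; bounded = λ { (suc k) (s≤s n<k) → trans (coeff-linear-* _ p k)
            (trans (+-cong (trans (*-congˡ (bounded (suc k) (ℕ.m≤n⇒m≤1+n n<k))) (zeroʳ _))
                           (bounded k n<k))
                   (+-identityʳ 0#)) }
        }
        where
        open Monic (go ζs)
        p = ∏ₚ[ ζs ] linear

    Φ̂ : Poly
    Φ̂ = proj₁ (divMod Φ degΦ (X^ f −1))

    -- For p ∈ ℚ[x] the remainder is the same in ℚ[x] and in K[x].
    ⟨_⟩R : Poly → Poly
    ⟨ p ⟩R = proj₂ (divMod Φ degΦ p)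

    ⟨⟩R-congruent : ∀ p → p ≡ₚ ⟨ p ⟩R [mod Φ ]
    ⟨⟩R-congruent p = proj₁ (divMod Φ degΦ p) , divMod-correct Φ degΦ p

    ⟨⟩R-degree : ∀ p k → degΦ ℕ.≤ k → coeff ⟨ p ⟩R k ≈ 0#
    ⟨⟩R-degree = divMod-bounded Φ-monic

    θ : Poly
    θ = List.replicate f 1#

    v : ℕ → Poly
    v a = ⟨ (- 1/ℕ f) ·ₚ (X^ a *ₚ (θ ′ ∘ₚ X^ a)) ⟩R

  module Wave {f : ℕ} .{{_ : NonTrivial f}} (𝒫 : PrimitiveRoots f)
              {N : ℕ} (a : Vector ℕ N) (a>0 : ∀ i → NonZero (a i)) where

    open Cyclotomic 𝒫 public

    f∣a f∤a : List (Fin N)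
    f∣a = filter (λ i → f ∣? a i) (allFin N)
    f∤a = filter (λ i → ¬? (f ∣? a i)) (allFin N)

    n : ℕ
    n = length f∣a

    W : ℤ → Carrier
    W t = - Res (∑ₗ[ roots ] λ ζ →
      fromSeries (root^_ ζ (ℤ.- t) ·ₛ exp (fromℤ (ℤ.- t)))
        *ₗ ∏ₗ[ allFin N ] λ i →
             1/ₗ (factor ζ (a i)) (factor-hasOrder ζ (a i) {{a>0 i}}))

    gProduct : PrimitiveRoot f → Series
    gProduct ζ =
         (∏ₛ[ f∣a ] λ i → g ⟨ fromℕ (a i) s⟩)
      *ₛ (∏ₛ[ f∤a ] λ i → g[s, eval (v (a i)) (value ζ) - 1# ] ⟨ fromℕ (a i) s⟩)

    𝒲 : ℤ → PrimitiveRoot f → Series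
    𝒲 t ζ = (root^_ ζ (ℤ.- t) * ∏[ f∤a ] λ i → eval (v (a i)) (value ζ)) ·ₛ gProduct ζ

    IsM̂ : (ℕ → List ℚ) → Set (c ⊔ ℓ₁ ⊔ ℓ₂)
    IsM̂ M̂ = ∀ (ζ : PrimitiveRoot f) →
      gProduct ζ ≈[< n ] λ k → eval (List.map fromℚ (M̂ k)) (value ζ)

    M : (ℕ → List ℚ) → ℕ → Poly
    M M̂ m = ⟨ List.map fromℚ (M̂ (n ℕ.∸ 1 ℕ.∸ m)) *ₚ ∏ₚ[ f∤a ] (λ i → v (a i)) ⟩R

    ∏a : ℕ
    ∏a = ℕ.product (List.map a f∣a)

    m!∏a≢0 : ∀ m → NonZero (m ! ℕ.* ∏a)
    m!∏a≢0 m = ℕ.m*n≢0 (m !) ∏a {{m ℕ.!≢0}}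
      {{ℕ.product≢0 (All.map⁺ (universal a>0 f∣a))}}

    P : (ℕ → Fin f → Carrier) → Fin f → Poly
    P c i = List.map
      (λ m → (- 1#) ^ (n ℕ.+ m ℕ.+ 1) * 1/ℕ (m ! ℕ.* ∏a) {{m!∏a≢0 m}} * c m i)
      (List.upTo n)

  -- F(t) = [P₁(t), …, P_f(t)].  The constituent Pᵢ is P at the element of
  -- Fin f with value i − 1.
  infix 4 _≐[_]
  _≐[_] : ∀ {f} → (ℤ → Carrier) → (Fin f → Poly) → Set ℓ₁
  _≐[_] {f} F P = ∀ (t : ℤ) (i : Fin f) →
    t ≡ + suc (toℕ i) [mod f ] → F t ≈ eval (P i) (fromℤ t)

{-# OPTIONS --safe #-}
module Submission where

-- Fourier inversion on the f-th roots of unity, done inside the polynomial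
-- ring.  The roots of Φ are pairwise apart f-th roots of unity, so
-- X^f − 1 = Φ̂ Φ.  For any polynomial M the product M Φ′ is congruent modulo Φ
-- to ∑ M(ζ) Φ/(X − ζ), the sum over the primitive roots ζ, because
-- Φ′ = ∑ Φ/(X − ζ) and M − M(ζ) is a multiple of X − ζ.  Multiplying by Φ̂,
-- M Φ̂ Φ′ is congruent modulo X^f − 1 to ∑ M(ζ) (X^f − 1)/(X − ζ), and
-- (X^f − 1)/(X − ζ) = ∑ ζ^(−i−1) X^i over 0 ≤ i < f.  Both this sum and
-- ∑ c_i X^i have degree below f, hence c_i = ∑ M(ζ) ζ^(−i−1).  The steps are
-- `roots⇒multiple` and `Φ̂⊛Φ`, `interpolation`, `[X^f-1]/linear`,
-- `monic-multiple` and `coefficients-as-sums`.  For M = M_m the right-hand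
-- side is the coefficient of s^(n−1−m) in ∑ 𝒲_f(t; a, ζ) whenever
-- t ≡ i + 1 modulo f, because ζ^(−t) depends only on t modulo f
-- (`root^-neg`, `wave-coefficient`).
--
-- For the wave itself, the inverse of a factor 1 − ζ^a e^(as) is
-- − (1/a) s^(−1) g(as) when f divides a, and v(ζ) g(as, v(ζ) − 1) otherwise;
-- the latter uses v(ζ) (1 − ζ^a) = 1, which follows from
-- (1 − w) w θ′(w) = − f for an f-th root of unity w apart from 1
-- (`series-1/factor-∣`, `series-1/factor-∤`, `v-inverse`).  The product of the
-- inverses therefore has a pole of order n, and its residue against
-- ζ^(−t) e^(−ts) is a Cauchy product of the coefficients (−t)^m/m! with the
-- coefficients of s^(n−1−m) in 𝒲_f(t; a, ζ), up to the factor (−1)^n/∏ a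
-- (`expansion`, `Res-term`).  Summing over ζ and inserting the formula
-- for the c_{m,i} gives the polynomial (`W-polynomial`).
--
-- Identities of polynomials are proved in the commutative ring of formal
-- power series, into which `coeff` maps the polynomials homomorphically.

open import Defs
open import Algebra.Apartness.Bundles using (HeytingField; HeytingCommutativeRing)
import Algebra.Apartness.Properties.HeytingCommutativeRing as ApartProperties
open import Algebra.Bundles using (CommutativeRing; RawRing)
import Algebra.Properties.CommutativeSemiring.Exp as CommExpProperties
import Algebra.Properties.Ring as RingProperties
import Algebra.Properties.Semiring.Exp as ExpProperties
import Algebra.Properties.Semiring.Mult as MultProperties
import Algebra.Properties.Semiring.Mult.TCOptimised as TCMultProperties
import Algebra.Properties.Semiring.Sum as SumProperties
import Algebra.Solver.Ring as RingSolver
open import Algebra.Solver.Ring.AlmostCommutativeRing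
  using (fromCommutativeRing; _-Raw-AlmostCommutative⟶_)
open import Data.Nat.Base as ℕ using (ℕ; zero; suc; NonZero; NonTrivial)
import Data.Nat.Properties as ℕₚ
import Data.Nat.ListAction as ℕ using (product)
open import Data.Nat.Divisibility using (_∣_; _∤_; _∣?_; divides)
open import Data.Integer.Base as ℤ using (ℤ; +_; -[1+_])
import Data.Integer.Properties as ℤₚ
open import Data.Rational.Base using (ℚ)
open import Data.Fin.Base as Fin using (Fin; toℕ)
import Data.Fin.Properties as Finₚ
open import Data.List.Base as List
  using (List; []; _∷_; tabulate; filter; allFin; length; replicate)
open import Data.List.Membership.Propositional using (_∈_)
open import Data.List.Membership.Propositional.Properties using (∈-filter⁺; ∈-allFin)
open import Data.List.Properties using (filter-accept; filter-reject)
open import Data.List.Relation.Unary.All as All using (All; []; _∷_)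
open import Data.List.Relation.Unary.AllPairs using (AllPairs; []; _∷_)
open import Data.List.Relation.Unary.Any using (Any; here; there)
open import Data.Maybe.Base using (Maybe; map)
open import Data.Product.Base using (∃; _×_; _,_; proj₁; proj₂)
open import Data.Sum.Base using (_⊎_; inj₁; inj₂)
open import Data.Vec.Functional using (Vector)
open import Function.Base using (_∘_)
open import Relation.Nullary using (Dec; yes; no; ¬?; contradiction)
open import Relation.Binary.Consequences using (dec⇒weaklyDec)
open import Relation.Binary.PropositionalEquality.Core as ≡ using (_≡_)
import Relation.Binary.Reasoning.Setoid as SetoidReasoning

-- A ring solver with integer coefficients, for an arbitrary commutative ring

module IntegerSolver {c ℓ} (R : CommutativeRing c ℓ) where
  open CommutativeRing R
  open RingProperties ring
  open TCMultProperties semiring renaming (_×_ to _×ᵣ_)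
  open SetoidReasoning setoid

  -- The image of an integer in R, with 1 sent to 1# on the nose, so that
  -- con (+ 1) denotes 1#.
  ι : ℤ → Carrier
  ι (+ n)    = n ×ᵣ 1#
  ι -[1+ n ] = - (suc n ×ᵣ 1#)

  private
    ι-⊖ : ∀ m n → ι (m ℤ.⊖ n) ≈ m ×ᵣ 1# - n ×ᵣ 1#
    ι-⊖ m       zero    = sym (trans (+-congˡ -0#≈0#) (+-identityʳ _))
    ι-⊖ zero    (suc n) = sym (+-identityˡ _)
    ι-⊖ (suc m) (suc n) = begin
      ι (suc m ℤ.⊖ suc n)                  ≡⟨ ≡.cong ι (ℤₚ.[1+m]⊖[1+n]≡m⊖n m n) ⟩
      ι (m ℤ.⊖ n)                          ≈⟨ ι-⊖ m n ⟩
      m ×ᵣ 1# - n ×ᵣ 1#                      ≈⟨ +-congʳ (+-identityˡ _) ⟨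
      0# + m ×ᵣ 1# - n ×ᵣ 1#                 ≈⟨ +-congʳ (+-congʳ (-‿inverseʳ 1#)) ⟨
      1# - 1# + m ×ᵣ 1# - n ×ᵣ 1#            ≈⟨ +-congʳ (+-assoc _ _ _) ⟩
      1# + (- 1# + m ×ᵣ 1#) - n ×ᵣ 1#        ≈⟨ +-congʳ (+-congˡ (+-comm _ _)) ⟩
      1# + (m ×ᵣ 1# - 1#) - n ×ᵣ 1#          ≈⟨ +-congʳ (+-assoc _ _ _) ⟨
      1# + m ×ᵣ 1# - 1# - n ×ᵣ 1#            ≈⟨ +-assoc _ _ _ ⟩
      1# + m ×ᵣ 1# + (- 1# - n ×ᵣ 1#)        ≈⟨ +-congˡ (-‿+-comm 1# (n ×ᵣ 1#)) ⟩
      1# + m ×ᵣ 1# - (1# + n ×ᵣ 1#)          ≈⟨ +-cong (1+× m 1#) (-‿cong (1+× n 1#)) ⟨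
      suc m ×ᵣ 1# - suc n ×ᵣ 1#              ∎

    ι-neg : ∀ i → ι (ℤ.- i) ≈ - ι i
    ι-neg (+ zero)  = sym -0#≈0#
    ι-neg (+ suc n) = refl
    ι-neg -[1+ n ]  = sym (-‿involutive _)

    ι-+ : ∀ i j → ι (i ℤ.+ j) ≈ ι i + ι j
    ι-+ (+ m)    (+ n)    = ×-homo-+ 1# m n
    ι-+ (+ m)    -[1+ n ] = ι-⊖ m (suc n)
    ι-+ -[1+ m ] (+ n)    = trans (ι-⊖ n (suc m)) (+-comm _ _)
    ι-+ -[1+ m ] -[1+ n ] = begin
      - (suc (suc (m ℕ.+ n)) ×ᵣ 1#)           ≡⟨ ≡.cong (λ k → - (suc k ×ᵣ 1#)) (ℕ+-suc m n) ⟨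
      - ((suc m ℕ.+ suc n) ×ᵣ 1#)             ≈⟨ -‿cong (×-homo-+ 1# (suc m) (suc n)) ⟩
      - (suc m ×ᵣ 1# + suc n ×ᵣ 1#)            ≈⟨ -‿+-comm _ _ ⟨
      - (suc m ×ᵣ 1#) - (suc n ×ᵣ 1#)          ∎
      where open import Data.Nat.Properties using () renaming (+-suc to ℕ+-suc)

    ι-pos-* : ∀ m j → ι (+ m ℤ.* j) ≈ ι (+ m) * ι j
    ι-pos-* m (+ n)    = trans (reflexive (≡.cong ι (≡.sym (ℤₚ.pos-* m n)))) (×1-homo-* m n)
    ι-pos-* m -[1+ n ] = begin
      ι (+ m ℤ.* -[1+ n ])        ≡⟨ ≡.cong ι (ℤₚ.neg-distribʳ-* (+ m) (+ suc n)) ⟨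
      ι (ℤ.- (+ m ℤ.* + suc n))   ≈⟨ ι-neg (+ m ℤ.* + suc n) ⟩
      - ι (+ m ℤ.* + suc n)       ≈⟨ -‿cong (ι-pos-* m (+ suc n)) ⟩
      - (m ×ᵣ 1# * suc n ×ᵣ 1#)     ≈⟨ -‿distribʳ-* _ _ ⟩
      m ×ᵣ 1# * - (suc n ×ᵣ 1#)     ∎

    ι-* : ∀ i j → ι (i ℤ.* j) ≈ ι i * ι j
    ι-* (+ m)    j = ι-pos-* m j
    ι-* -[1+ m ] j = begin
      ι (-[1+ m ] ℤ.* j)        ≡⟨ ≡.cong ι (ℤₚ.neg-distribˡ-* (+ suc m) j) ⟨
      ι (ℤ.- (+ suc m ℤ.* j))   ≈⟨ ι-neg (+ suc m ℤ.* j) ⟩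
      - ι (+ suc m ℤ.* j)       ≈⟨ -‿cong (ι-pos-* (suc m) j) ⟩
      - (suc m ×ᵣ 1# * ι j)      ≈⟨ -‿distribˡ-* _ _ ⟩
      - (suc m ×ᵣ 1#) * ι j      ∎

    ℤ-rawRing : RawRing _ _
    ℤ-rawRing = record
      { _≈_ = _≡_ ; _+_ = ℤ._+_ ; _*_ = ℤ._*_ ; -_ = ℤ.-_ ; 0# = + 0 ; 1# = + 1 }

    morphism : ℤ-rawRing -Raw-AlmostCommutative⟶ fromCommutativeRing R
    morphism = record
      { ⟦_⟧ = ι ; +-homo = ι-+ ; *-homo = ι-* ; -‿homo = ι-neg ; 0-homo = refl ; 1-homo = refl }

    dec : ∀ i j → Maybe (ι i ≈ ι j)
    dec i j = map (λ { ≡.refl → refl }) (dec⇒weaklyDec ℤₚ._≟_ i j)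

  open RingSolver ℤ-rawRing (fromCommutativeRing R) morphism dec public
    using (solve; _:=_; _:+_; _:*_; _:-_; :-_; con)

module OverField {c ℓ₁ ℓ₂} (K : HeytingField c ℓ₁ ℓ₂) (char0 : CharZero K) where
  open Over K char0

  fieldRing : CommutativeRing c ℓ₁
  fieldRing =
    HeytingCommutativeRing.commutativeRing (HeytingField.heytingCommutativeRing K)

  open CommutativeRing fieldRing
    using ( setoid; refl; sym; trans; reflexive; ring; semiring; commutativeSemiring
          ; +-cong; +-congˡ; +-congʳ; +-assoc; +-comm; +-identityˡ; +-identityʳ
          ; -‿cong; -‿inverseˡ; -‿inverseʳ
          ; *-cong; *-congˡ; *-congʳ; *-assoc; *-comm; *-identityˡ; *-identityʳ
          ; distribˡ; distribʳ; zeroˡ; zeroʳ )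
  open RingProperties ring using (-0#≈0#; -‿distribˡ-*; x∙y⁻¹≈ε⇒x≈y; -1*x≈-x)
  module Exp = ExpProperties semiring
  module CommExp = CommExpProperties commutativeSemiring
  module Mult = MultProperties semiring
  module ≈-Reasoning = SetoidReasoning setoid
  open IntegerSolver fieldRing
  open SumProperties semiring using (sum-cong-≋; *-distribˡ-sum; ∑-distrib-+; sum-replicate-zero)
  module Apart = ApartProperties (HeytingField.heytingCommutativeRing K)

  -- Division in K

  *-invˡ : ∀ {x} (x#0 : x # 0#) → inv x#0 * x ≈ 1#
  *-invˡ x#0 = trans (*-comm _ _) (*-inv x#0)

  *-cancelˡ-# : ∀ {x y z} → x # 0# → x * y ≈ x * z → y ≈ z
  *-cancelˡ-# {x} {y} {z} x#0 xy≈xz = begin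
    y                    ≈⟨ *-identityˡ y ⟨
    1# * y               ≈⟨ *-congʳ (*-invˡ x#0) ⟨
    inv x#0 * x * y      ≈⟨ *-assoc _ _ _ ⟩
    inv x#0 * (x * y)    ≈⟨ *-congˡ xy≈xz ⟩
    inv x#0 * (x * z)    ≈⟨ *-assoc _ _ _ ⟨
    inv x#0 * x * z      ≈⟨ *-congʳ (*-invˡ x#0) ⟩
    1# * z               ≈⟨ *-identityˡ z ⟩
    z                    ∎
    where open ≈-Reasoning

  #0⇒*≈0⇒≈0 : ∀ {x y} → x # 0# → x * y ≈ 0# → y ≈ 0#
  #0⇒*≈0⇒≈0 x#0 xy≈0 = *-cancelˡ-# x#0 (trans xy≈0 (sym (zeroʳ _)))

  #⇒-#0 : ∀ {x y} → x # y → x - y # 0#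
  #⇒-#0 x#y = *≈1⇒#0 (proj₂ (proj₂ (HeytingField.#⇒invertible K x#y)))

  1^ : ∀ n → 1# ^ n ≈ 1#
  1^ zero    = refl
  1^ (suc n) = trans (*-identityˡ _) (1^ n)

  -- The ring of formal power series

  infix 4 _≋_
  -- Coefficientwise equality, as a record so that the two series can be
  -- inferred from a proof.
  record _≋_ (F G : Series) : Set ℓ₁ where
    constructor ⟪_⟫
    field at : ∀ k → F k ≈ G k
  open _≋_ public

  -ₛ_ : Series → Series
  (-ₛ F) k = - F k

  -- The product of F with the variable
  X∙ : Series → Series
  X∙ F zero    = 0#
  X∙ F (suc k) = F k

  *ₛ-cong : ∀ {F F′ G G′} → (∀ k → F k ≈ F′ k) → (∀ k → G k ≈ G′ k) →
               ∀ k → (F *ₛ G) k ≈ (F′ *ₛ G′) k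
  *ₛ-cong p q zero    = +-congʳ (*-cong (p 0) (q 0))
  *ₛ-cong p q (suc k) =
    +-cong (*-cong (p 0) (q (suc k))) (*ₛ-cong (p ∘ suc) q k)

  *ₛ-distribʳ : ∀ F G H → (G +ₛ H) *ₛ F ≋ G *ₛ F +ₛ H *ₛ F
  *ₛ-distribʳ F G H = ⟪ go G H ⟫
    where
    go : ∀ G H k → ((G +ₛ H) *ₛ F) k ≈ (G *ₛ F) k + (H *ₛ F) k
    go G H zero    =
      solve 3 (λ g h f → (g :+ h) :* f :+ con (+ 0) := (g :* f :+ con (+ 0)) :+ (h :* f :+ con (+ 0)))
        refl (G 0) (H 0) (F 0)
    go G H (suc k) = trans (+-congˡ (go (G ∘ suc) (H ∘ suc) k))
      (solve 5 (λ g h f a b → (g :+ h) :* f :+ (a :+ b) := (g :* f :+ a) :+ (h :* f :+ b))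
        refl (G 0) (H 0) (F (suc k)) (((G ∘ suc) *ₛ F) k) (((H ∘ suc) *ₛ F) k))

  *ₛ-·ₛ-assoc : ∀ x F G → (x ·ₛ F) *ₛ G ≋ x ·ₛ (F *ₛ G)
  *ₛ-·ₛ-assoc x F G = ⟪ go F ⟫
    where
    go : ∀ F k → ((x ·ₛ F) *ₛ G) k ≈ x * (F *ₛ G) k
    go F zero    = solve 3 (λ x f g → x :* f :* g :+ con (+ 0) := x :* (f :* g :+ con (+ 0)))
      refl x (F 0) (G 0)
    go F (suc k) = trans (+-congˡ (go (F ∘ suc) k))
      (solve 4 (λ x f g a → x :* f :* g :+ x :* a := x :* (f :* g :+ a))
        refl x (F 0) (G (suc k)) (((F ∘ suc) *ₛ G) k))

  *ₛ-assoc : ∀ F G H → (F *ₛ G) *ₛ H ≋ F *ₛ (G *ₛ H)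
  *ₛ-assoc F G H = ⟪ go F ⟫
    where
    open ≈-Reasoning
    go : ∀ F k → ((F *ₛ G) *ₛ H) k ≈ (F *ₛ (G *ₛ H)) k
    go F zero    = solve 3 (λ f g h → (f :* g :+ con (+ 0)) :* h :+ con (+ 0) := f :* (g :* h :+ con (+ 0)) :+ con (+ 0))
      refl (F 0) (G 0) (H 0)
    -- (F G)∘suc = F₀ (G∘suc) + (F∘suc) G
    go F (suc k) = begin
      (F 0 * G 0 + 0#) * H (suc k) + (((F 0 ·ₛ (G ∘ suc)) +ₛ ((F ∘ suc) *ₛ G)) *ₛ H) k
        ≈⟨ +-congˡ (at (*ₛ-distribʳ H (F 0 ·ₛ (G ∘ suc)) ((F ∘ suc) *ₛ G)) k) ⟩
      (F 0 * G 0 + 0#) * H (suc k) + (((F 0 ·ₛ (G ∘ suc)) *ₛ H) k + (((F ∘ suc) *ₛ G) *ₛ H) k)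
        ≈⟨ +-congˡ (+-cong (at (*ₛ-·ₛ-assoc (F 0) (G ∘ suc) H) k) (go (F ∘ suc) k)) ⟩
      (F 0 * G 0 + 0#) * H (suc k) + (F 0 * ((G ∘ suc) *ₛ H) k + ((F ∘ suc) *ₛ (G *ₛ H)) k)
        ≈⟨ solve 5 (λ f g h a b → (f :* g :+ con (+ 0)) :* h :+ (f :* a :+ b) := f :* (g :* h :+ a) :+ b)
             refl (F 0) (G 0) (H (suc k)) (((G ∘ suc) *ₛ H) k) (((F ∘ suc) *ₛ (G *ₛ H)) k) ⟩
      F 0 * (G 0 * H (suc k) + ((G ∘ suc) *ₛ H) k) + ((F ∘ suc) *ₛ (G *ₛ H)) k ∎

  -- The recursion of the Cauchy product in its second argument
  *ₛ-sucʳ : ∀ F G k → (F *ₛ G) (suc k) ≈ F (suc k) * G 0 + (F *ₛ (G ∘ suc)) k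
  *ₛ-sucʳ F G zero    =
    solve 4 (λ f f′ g g′ → f :* g′ :+ (f′ :* g :+ con (+ 0)) := f′ :* g :+ (f :* g′ :+ con (+ 0)))
      refl (F 0) (F 1) (G 0) (G 1)
  *ₛ-sucʳ F G (suc k) = trans (+-congˡ (*ₛ-sucʳ (F ∘ suc) G k))
    (solve 3 (λ x y z → x :+ (y :+ z) := y :+ (x :+ z)) refl
      (F 0 * G (suc (suc k))) (F (suc (suc k)) * G 0) (((F ∘ suc) *ₛ (G ∘ suc)) k))

  *ₛ-comm : ∀ F G → F *ₛ G ≋ G *ₛ F
  *ₛ-comm F G = ⟪ go F ⟫
    where
    go : ∀ F k → (F *ₛ G) k ≈ (G *ₛ F) k
    go F zero    = +-congʳ (*-comm _ _)
    go F (suc k) = trans (+-cong (*-comm _ _) (go (F ∘ suc) k)) (sym (*ₛ-sucʳ G F k))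

  private
    0ₛ-*ₛ : ∀ F k → (0ₛ *ₛ F) k ≈ 0#
    0ₛ-*ₛ F zero    = trans (+-identityʳ _) (zeroˡ _)
    0ₛ-*ₛ F (suc k) = trans (+-cong (zeroˡ _) (0ₛ-*ₛ F k)) (+-identityʳ _)

    1ₛ-*ₛ : ∀ F k → (1ₛ *ₛ F) k ≈ F k
    1ₛ-*ₛ F zero    = trans (+-identityʳ _) (*-identityˡ _)
    1ₛ-*ₛ F (suc k) = trans (+-cong (*-identityˡ _) (0ₛ-*ₛ F k)) (+-identityʳ _)

  infixl 7 _⊛_
  opaque
    -- The Cauchy product as an opaque operation: unlike those of _*ₛ_, its
    -- factors can be recovered by unification.
    _⊛_ : Series → Series → Series
    _⊛_ = _*ₛ_

    *ₛ≋⊛ : ∀ F G → F *ₛ G ≋ F ⊛ G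
    *ₛ≋⊛ F G = ⟪ (λ _ → refl) ⟫

    ⊛-zero : ∀ F G → (F ⊛ G) 0 ≈ F 0 * G 0
    ⊛-zero F G = +-identityʳ _

    ⊛-suc : ∀ F G k → (F ⊛ G) (suc k) ≈ F 0 * G (suc k) + ((F ∘ suc) ⊛ G) k
    ⊛-suc F G k = refl

    ⊛-cong : ∀ {F F′ G G′} → F ≋ F′ → G ≋ G′ → F ⊛ G ≋ F′ ⊛ G′
    ⊛-cong p q = ⟪ *ₛ-cong (at p) (at q) ⟫

    ⊛-assoc : ∀ F G H → (F ⊛ G) ⊛ H ≋ F ⊛ (G ⊛ H)
    ⊛-assoc = *ₛ-assoc

    ⊛-comm : ∀ F G → F ⊛ G ≋ G ⊛ F
    ⊛-comm = *ₛ-comm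

    ⊛-distribʳ : ∀ F G H → (G +ₛ H) ⊛ F ≋ G ⊛ F +ₛ H ⊛ F
    ⊛-distribʳ = *ₛ-distribʳ

    ⊛-identityˡ : ∀ F → 1ₛ ⊛ F ≋ F
    ⊛-identityˡ F = ⟪ 1ₛ-*ₛ F ⟫

    ·ₛ-⊛-assoc : ∀ x F G → (x ·ₛ F) ⊛ G ≋ x ·ₛ (F ⊛ G)
    ·ₛ-⊛-assoc = *ₛ-·ₛ-assoc

    X∙-⊛ : ∀ F G → X∙ F ⊛ G ≋ X∙ (F ⊛ G)
    X∙-⊛ F G = ⟪ (λ { zero    → trans (+-identityʳ _) (zeroˡ _)
                    ; (suc k) → trans (+-congʳ (zeroˡ _)) (+-identityˡ _) }) ⟫

  seriesRing : CommutativeRing c ℓ₁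
  seriesRing = record
    { Carrier = Series ; _≈_ = _≋_ ; _+_ = _+ₛ_ ; _*_ = _⊛_ ; -_ = -ₛ_ ; 0# = 0ₛ ; 1# = 1ₛ
    ; isCommutativeRing = record
      { isRing = record
        { +-isAbelianGroup = record
          { isGroup = record
            { isMonoid = record
              { isSemigroup = record
                { isMagma = record
                  { isEquivalence = record
                    { refl  = ⟪ (λ _ → refl) ⟫
                    ; sym   = λ p → ⟪ (λ k → sym (at p k)) ⟫
                    ; trans = λ p q → ⟪ (λ k → trans (at p k) (at q k)) ⟫ }
                  ; ∙-cong = λ p q → ⟪ (λ k → +-cong (at p k) (at q k)) ⟫ }
                ; assoc = λ _ _ _ → ⟪ (λ _ → +-assoc _ _ _) ⟫ }
              ; identity = (λ _ → ⟪ (λ _ → +-identityˡ _) ⟫) , (λ _ → ⟪ (λ _ → +-identityʳ _) ⟫) }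
            ; inverse = (λ _ → ⟪ (λ _ → -‿inverseˡ _) ⟫) , (λ _ → ⟪ (λ _ → -‿inverseʳ _) ⟫)
            ; ⁻¹-cong = λ p → ⟪ (λ k → -‿cong (at p k)) ⟫ }
          ; comm = λ _ _ → ⟪ (λ _ → +-comm _ _) ⟫ }
        ; *-cong = ⊛-cong
        ; *-assoc = ⊛-assoc
        ; *-identity = (λ F → ⊛-identityˡ F)
                     , (λ F → ⟪ (λ k → trans (at (⊛-comm F 1ₛ) k) (at (⊛-identityˡ F) k)) ⟫)
        ; distrib = (λ F G H → ⟪ (λ k → trans (at (⊛-comm F (G +ₛ H)) k)
                        (trans (at (⊛-distribʳ F G H) k)
                               (+-cong (at (⊛-comm G F) k) (at (⊛-comm H F) k)))) ⟫)
                  , ⊛-distribʳ }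
      ; *-comm = ⊛-comm } }

  module 𝕊 where
    open CommutativeRing seriesRing public
      using ( refl; sym; trans
            ; +-cong; +-congˡ; +-congʳ; +-assoc; +-comm; +-identityˡ
            ; -‿cong; -‿inverseʳ
            ; *-cong; *-congˡ; *-congʳ; *-assoc; *-comm; *-identityˡ; *-identityʳ
            ; distribʳ; zeroˡ )
    open IntegerSolver seriesRing public using (solve; _:=_; _:+_; _:*_; _:-_; :-_; con)
    module ≋-Reasoning = SetoidReasoning (CommutativeRing.setoid seriesRing)

  -- The constant series x
  const : Carrier → Series
  const x = x ·ₛ 1ₛ

  ·ₛ≋const* : ∀ x F → x ·ₛ F ≋ const x ⊛ F
  ·ₛ≋const* x F = 𝕊.sym (𝕊.trans (·ₛ-⊛-assoc x 1ₛ F)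
    ⟪ (λ k → *-congˡ (at (𝕊.*-identityˡ F) k)) ⟫)

  ·ₛ-cong : ∀ {x y F G} → x ≈ y → F ≋ G → x ·ₛ F ≋ y ·ₛ G
  ·ₛ-cong x≈y F≋G = ⟪ (λ k → *-cong x≈y (at F≋G k)) ⟫

  const-cong : ∀ {x y} → x ≈ y → const x ≋ const y
  const-cong x≈y = ·ₛ-cong x≈y 𝕊.refl

  -- Polynomials as power series

  -- The variable as a power series
  X : Series
  X = X∙ 1ₛ

  X∙≋X* : ∀ F → X∙ F ≋ X ⊛ F
  X∙≋X* F = 𝕊.sym (𝕊.trans (X∙-⊛ 1ₛ F)
    ⟪ (λ { zero → refl ; (suc k) → at (𝕊.*-identityˡ F) k }) ⟫)

  X∙-cong : ∀ {F G} → F ≋ G → X∙ F ≋ X∙ G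
  X∙-cong p = ⟪ (λ { zero → refl ; (suc k) → at p k }) ⟫

  coeff-∷ : ∀ x p → coeff (x ∷ p) ≋ const x +ₛ X ⊛ coeff p
  coeff-∷ x p = 𝕊.trans
    ⟪ (λ { zero    → sym (trans (+-identityʳ _) (*-identityʳ x))
         ; (suc k) → sym (trans (+-congʳ (zeroʳ x)) (+-identityˡ _)) }) ⟫
    (𝕊.+-congˡ {const x} (X∙≋X* (coeff p)))

  coeff-[] : coeff [] ≋ 0ₛ
  coeff-[] = ⟪ (λ _ → refl) ⟫

  coeff-+ : ∀ p q → coeff (p +ₚ q) ≋ coeff p +ₛ coeff q
  coeff-+ p q = ⟪ go p q ⟫
    where
    go : ∀ p q k → coeff (p +ₚ q) k ≈ coeff p k + coeff q k
    go []      q       k       = sym (+-identityˡ _)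
    go (x ∷ p) []      k       = sym (+-identityʳ _)
    go (x ∷ p) (y ∷ q) zero    = refl
    go (x ∷ p) (y ∷ q) (suc k) = go p q k

  coeff-· : ∀ x p → coeff (x ·ₚ p) ≋ x ·ₛ coeff p
  coeff-· x p = ⟪ go p ⟫
    where
    go : ∀ p k → coeff (x ·ₚ p) k ≈ x * coeff p k
    go []      k       = sym (zeroʳ x)
    go (y ∷ p) zero    = refl
    go (y ∷ p) (suc k) = go p k

  coeff-* : ∀ p q → coeff (p *ₚ q) ≋ coeff p ⊛ coeff q
  coeff-* []      q = 𝕊.sym (𝕊.trans (𝕊.*-congʳ coeff-[]) (𝕊.zeroˡ (coeff q)))
  coeff-* (x ∷ p) q = begin
    coeff (x ·ₚ q +ₚ (0# ∷ p *ₚ q))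
      ≈⟨ coeff-+ (x ·ₚ q) (0# ∷ p *ₚ q) ⟩
    coeff (x ·ₚ q) +ₛ coeff (0# ∷ p *ₚ q)
      ≈⟨ 𝕊.+-cong (𝕊.trans (coeff-· x q) (·ₛ≋const* x (coeff q))) (coeff-∷ 0# (p *ₚ q)) ⟩
    const x ⊛ coeff q +ₛ (const 0# +ₛ X ⊛ coeff (p *ₚ q))
      ≈⟨ 𝕊.+-congˡ (𝕊.+-cong ⟪ (λ _ → zeroˡ _) ⟫ (𝕊.*-congˡ (coeff-* p q))) ⟩
    const x ⊛ coeff q +ₛ (0ₛ +ₛ X ⊛ (coeff p ⊛ coeff q))
      ≈⟨ 𝕊.solve 4 (λ a b X p → a 𝕊.:* b 𝕊.:+ (𝕊.con (+ 0) 𝕊.:+ X 𝕊.:* (p 𝕊.:* b)) 𝕊.:= (a 𝕊.:+ X 𝕊.:* p) 𝕊.:* b)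
           𝕊.refl (const x) (coeff q) X (coeff p) ⟩
    (const x +ₛ X ⊛ coeff p) ⊛ coeff q
      ≈⟨ 𝕊.*-congʳ (coeff-∷ x p) ⟨
    coeff (x ∷ p) ⊛ coeff q ∎
    where open 𝕊.≋-Reasoning

  -- A multiple q d of a monic polynomial d of degree n vanishes, and q with
  -- it, if its coefficients from n on do.
  monic-multiple : ∀ {d n} → Monic d n → ∀ q →
                   (∀ k → n ℕ.≤ k → (coeff q ⊛ coeff d) k ≈ 0#) → coeff q ≋ 0ₛ
  monic-multiple             monic []      high = coeff-[]
  monic-multiple {d} {n} monic (x ∷ q) high =
    ⟪ (λ { zero → x≈0 ; (suc k) → at q≋0 k }) ⟫
    where
    open ≈-Reasoning
    q≋0 : coeff q ≋ 0ₛ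
    q≋0 = monic-multiple monic q λ k n≤k → begin
      (coeff q ⊛ coeff d) k                          ≈⟨ +-identityˡ _ ⟨
      0# + (coeff q ⊛ coeff d) k
        ≈⟨ +-congʳ (trans (*-congˡ (Monic.bounded monic (suc k) (ℕ.s≤s n≤k))) (zeroʳ x)) ⟨
      x * coeff d (suc k) + (coeff q ⊛ coeff d) k    ≈⟨ ⊛-suc (coeff (x ∷ q)) (coeff d) k ⟨
      (coeff (x ∷ q) ⊛ coeff d) (suc k)               ≈⟨ high (suc k) (ℕₚ.m≤n⇒m≤1+n n≤k) ⟩
      0#                                              ∎
    x≈0 : x ≈ 0#
    x≈0 = begin
      x                                               ≈⟨ *-identityʳ x ⟨
      x * 1#                                          ≈⟨ *-congˡ (Monic.leading monic) ⟨
      x * coeff d n                                   ≈⟨ top n ⟨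
      (coeff (x ∷ q) ⊛ coeff d) n                    ≈⟨ high n ℕₚ.≤-refl ⟩
      0#                                              ∎
      where
      top : ∀ n → (coeff (x ∷ q) ⊛ coeff d) n ≈ x * coeff d n
      top zero    = ⊛-zero (coeff (x ∷ q)) (coeff d)
      top (suc n) = trans (⊛-suc (coeff (x ∷ q)) (coeff d) n) (trans (+-congˡ (trans (at (𝕊.*-congʳ {coeff d} q≋0) n) (at (𝕊.zeroˡ (coeff d)) n)))
                          (+-identityʳ _))

  -- Evaluation

  eval-cong : ∀ {p q} → coeff p ≋ coeff q → ∀ y → eval p y ≈ eval q y
  eval-cong {p} {q} p≋q y = go p q (at p≋q)
    where
    vanish : ∀ p → (∀ k → coeff p k ≈ 0#) → eval p y ≈ 0#
    vanish []      p≈0 = refl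
    vanish (x ∷ p) p≈0 =
      trans (+-cong (p≈0 0) (trans (*-congˡ (vanish p (p≈0 ∘ suc))) (zeroʳ y))) (+-identityʳ 0#)
    go : ∀ p q → (∀ k → coeff p k ≈ coeff q k) → eval p y ≈ eval q y
    go []      q       p≈q = sym (vanish q (λ k → sym (p≈q k)))
    go (x ∷ p) []      p≈q = vanish (x ∷ p) p≈q
    go (x ∷ p) (z ∷ q) p≈q = +-cong (p≈q 0) (*-congˡ (go p q (p≈q ∘ suc)))

  eval-+ : ∀ p q y → eval (p +ₚ q) y ≈ eval p y + eval q y
  eval-+ []      q       y = sym (+-identityˡ _)
  eval-+ (x ∷ p) []      y = sym (+-identityʳ _)
  eval-+ (x ∷ p) (z ∷ q) y = trans (+-congˡ (*-congˡ (eval-+ p q y)))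
    (solve 5 (λ x z y p q → x :+ z :+ y :* (p :+ q) := x :+ y :* p :+ (z :+ y :* q))
      refl x z y (eval p y) (eval q y))

  eval-· : ∀ x p y → eval (x ·ₚ p) y ≈ x * eval p y
  eval-· x []      y = sym (zeroʳ x)
  eval-· x (z ∷ p) y = trans (+-congˡ (*-congˡ (eval-· x p y)))
    (solve 4 (λ x z y p → x :* z :+ y :* (x :* p) := x :* (z :+ y :* p)) refl x z y (eval p y))

  eval-* : ∀ p q y → eval (p *ₚ q) y ≈ eval p y * eval q y
  eval-* []      q y = sym (zeroˡ _)
  eval-* (x ∷ p) q y = begin
    eval (x ·ₚ q +ₚ (0# ∷ p *ₚ q)) y
      ≈⟨ eval-+ (x ·ₚ q) (0# ∷ p *ₚ q) y ⟩
    eval (x ·ₚ q) y + (0# + y * eval (p *ₚ q) y)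
      ≈⟨ +-cong (eval-· x q y) (+-congˡ (*-congˡ (eval-* p q y))) ⟩
    x * eval q y + (0# + y * (eval p y * eval q y))
      ≈⟨ solve 4 (λ x q y p → x :* q :+ (con (+ 0) :+ y :* (p :* q)) := (x :+ y :* p) :* q)
           refl x (eval q y) y (eval p y) ⟩
    (x + y * eval p y) * eval q y ∎
    where open ≈-Reasoning

  eval-∘ : ∀ p q y → eval (p ∘ₚ q) y ≈ eval p (eval q y)
  eval-∘ []      q y = refl
  eval-∘ (x ∷ p) q y = begin
    eval ((x ∷ []) +ₚ q *ₚ (p ∘ₚ q)) y            ≈⟨ eval-+ (x ∷ []) (q *ₚ (p ∘ₚ q)) y ⟩
    x + y * 0# + eval (q *ₚ (p ∘ₚ q)) y           ≈⟨ +-cong (trans (+-congˡ (zeroʳ y)) (+-identityʳ x)) (eval-* q (p ∘ₚ q) y) ⟩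
    x + eval q y * eval (p ∘ₚ q) y                ≈⟨ +-congˡ (*-congˡ (eval-∘ p q y)) ⟩
    x + eval q y * eval p (eval q y)              ∎
    where open ≈-Reasoning

  eval-X^ : ∀ k y → eval (X^ k) y ≈ y ^ k
  eval-X^ zero    y = trans (+-congˡ (zeroʳ y)) (+-identityʳ 1#)
  eval-X^ (suc k) y = trans (+-identityˡ _) (*-congˡ (eval-X^ k y))

  eval-X^-1 : ∀ k y → eval (X^ k −1) y ≈ y ^ k - 1#
  eval-X^-1 k y = trans (eval-+ (X^ k) (- 1# ∷ []) y)
    (+-cong (eval-X^ k y) (trans (+-congˡ (zeroʳ y)) (+-identityʳ _)))

  eval-∏ : ∀ {ℓ} {I : Set ℓ} (is : List I) (h : I → Poly) y →
           eval (∏ₚ[ is ] h) y ≈ ∏[ is ] λ i → eval (h i) y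
  eval-∏ []       h y = trans (+-congˡ (zeroʳ y)) (+-identityʳ 1#)
  eval-∏ (i ∷ is) h y = trans (eval-* (h i) (∏ₚ[ is ] h) y) (*-congˡ (eval-∏ is h y))

  -- Linear factors

  -- X − z
  linear : Carrier → Poly
  linear z = - z ∷ 1# ∷ []

  eval-linear : ∀ z y → eval (linear z) y ≈ y - z
  eval-linear z y = solve 2 (λ z y → :- z :+ y :* (con (+ 1) :+ y :* con (+ 0)) := y :- z) refl z y

  const-+ : ∀ x y → const (x + y) ≋ const x +ₛ const y
  const-+ x y = ⟪ (λ k → distribʳ (1ₛ k) x y) ⟫

  const-* : ∀ x y → const (x * y) ≋ const x ⊛ const y
  const-* x y = 𝕊.trans ⟪ (λ k → *-assoc x y (1ₛ k)) ⟫ (·ₛ≋const* x (const y))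

  const-neg : ∀ x → const (- x) ≋ -ₛ const x
  const-neg x = ⟪ (λ k → sym (-‿distribˡ-* x (1ₛ k))) ⟫

  const-1 : const 1# ≋ 1ₛ
  const-1 = ⟪ (λ k → *-identityˡ (1ₛ k)) ⟫

  const-0 : const 0# ≋ 0ₛ
  const-0 = ⟪ (λ k → zeroˡ (1ₛ k)) ⟫

  coeff-linear : ∀ z → coeff (linear z) ≋ X -ₛ const z
  coeff-linear z = 𝕊.trans (coeff-∷ (- z) (1# ∷ []))
    (𝕊.trans (𝕊.+-cong (const-neg z) (𝕊.trans (𝕊.*-congˡ coeff-1) (𝕊.*-identityʳ X)))
             (𝕊.+-comm _ _))
    where
    coeff-1 : coeff (1# ∷ []) ≋ 1ₛ
    coeff-1 = ⟪ (λ { zero → refl ; (suc k) → refl }) ⟫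

  -- Horner's scheme: p = p(z) + (X − z) q
  factor-theorem : ∀ p z → ∃ λ q → coeff p ≋ const (eval p z) +ₛ coeff q ⊛ coeff (linear z)
  factor-theorem []      z = [] , 𝕊.sym
    (𝕊.trans (𝕊.+-cong const-0 (𝕊.trans (𝕊.*-congʳ coeff-[]) (𝕊.zeroˡ _))) (𝕊.+-identityˡ 0ₛ))
  factor-theorem (x ∷ p) z with q , p≋ ← factor-theorem p z = eval p z ∷ q , (begin
    coeff (x ∷ p)
      ≈⟨ coeff-∷ x p ⟩
    const x +ₛ X ⊛ coeff p
      ≈⟨ 𝕊.+-congˡ (𝕊.*-congˡ (𝕊.trans p≋ (𝕊.+-congˡ (𝕊.*-congˡ (coeff-linear z))))) ⟩
    const x +ₛ X ⊛ (const (eval p z) +ₛ coeff q ⊛ (X -ₛ const z))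
      ≈⟨ 𝕊.solve 5 (λ x X z e q → x 𝕊.:+ X 𝕊.:* (e 𝕊.:+ q 𝕊.:* (X 𝕊.:- z)) 𝕊.:=
                        x 𝕊.:+ z 𝕊.:* e 𝕊.:+ (e 𝕊.:+ X 𝕊.:* q) 𝕊.:* (X 𝕊.:- z))
           𝕊.refl (const x) X (const z) (const (eval p z)) (coeff q) ⟩
    const x +ₛ const z ⊛ const (eval p z) +ₛ (const (eval p z) +ₛ X ⊛ coeff q) ⊛ (X -ₛ const z)
      ≈⟨ 𝕊.+-cong (𝕊.trans (const-+ x (z * eval p z)) (𝕊.+-congˡ (const-* z (eval p z))))
                  (𝕊.*-cong (coeff-∷ (eval p z) q) (coeff-linear z)) ⟨
    const (x + z * eval p z) +ₛ coeff (eval p z ∷ q) ⊛ coeff (linear z) ∎)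
    where open 𝕊.≋-Reasoning

  -- A polynomial with pairwise apart roots zᵢ is a multiple of ∏ (X − zᵢ).
  roots⇒multiple : ∀ {ℓ} {I : Set ℓ} (z : I → Carrier) {is : List I} →
    AllPairs (λ i j → z i # z j) is → ∀ p → All (λ i → eval p (z i) ≈ 0#) is →
    ∃ λ q → coeff p ≋ coeff q ⊛ coeff (∏ₚ[ is ] (linear ∘ z))
  roots⇒multiple z []                p []           = p , 𝕊.sym
    (𝕊.trans (𝕊.*-congˡ ⟪ (λ { zero → refl ; (suc k) → refl }) ⟫) (𝕊.*-identityʳ (coeff p)))
  roots⇒multiple z {i ∷ is} (i# ∷ distinct) p (p[zᵢ]≈0 ∷ p≈0)
    with q , p≋ ← factor-theorem p (z i)
    = r , (begin
      coeff p                                       ≈⟨ p≋q* ⟩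
      coeff q ⊛ coeff (linear (z i))               ≈⟨ 𝕊.*-congʳ q≋ ⟩
      coeff r ⊛ coeff Π ⊛ coeff (linear (z i))    ≈⟨ 𝕊.*-assoc _ _ _ ⟩
      coeff r ⊛ (coeff Π ⊛ coeff (linear (z i)))  ≈⟨ 𝕊.*-congˡ (𝕊.*-comm _ _) ⟩
      coeff r ⊛ (coeff (linear (z i)) ⊛ coeff Π)  ≈⟨ 𝕊.*-congˡ (coeff-* (linear (z i)) Π) ⟨
      coeff r ⊛ coeff (linear (z i) *ₚ Π)          ∎)
    where
    open 𝕊.≋-Reasoning
    Π = ∏ₚ[ is ] (linear ∘ z)
    p≋q* : coeff p ≋ coeff q ⊛ coeff (linear (z i))
    p≋q* = 𝕊.trans p≋ (𝕊.trans (𝕊.+-congʳ (𝕊.trans (const-cong p[zᵢ]≈0) const-0)) (𝕊.+-identityˡ _))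
    q≈0 : ∀ {j} → z i # z j × eval p (z j) ≈ 0# → eval q (z j) ≈ 0#
    q≈0 {j} (zᵢ#zⱼ , p[zⱼ]≈0) = #0⇒*≈0⇒≈0 (#⇒-#0 (HeytingField.#-sym K zᵢ#zⱼ))
      (trans (*-comm _ _) (trans (*-congˡ (sym (eval-linear (z i) (z j))))
        (trans (sym (eval-* q (linear (z i)) (z j)))
          (trans (sym (eval-cong {p} {q *ₚ linear (z i)} (𝕊.trans p≋q* (𝕊.sym (coeff-* q (linear (z i))))) (z j))) p[zⱼ]≈0))))
    IH = roots⇒multiple z distinct q (All.map q≈0 (All.zip (i# , p≈0)))
    r = proj₁ IH
    q≋ = proj₂ IH

  -- Derivatives

  -- The formal derivative of a power series
  D : Series → Series
  D F k = fromℕ (suc k) * F (suc k)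

  D-cong : ∀ {F G} → F ≋ G → D F ≋ D G
  D-cong p = ⟪ (λ k → *-congˡ (at p (suc k))) ⟫

  D-+ : ∀ F G → D (F +ₛ G) ≋ D F +ₛ D G
  D-+ F G = ⟪ (λ k → distribˡ _ _ _) ⟫

  D-· : ∀ x F → D (x ·ₛ F) ≋ x ·ₛ D F
  D-· x F = ⟪ (λ k → solve 3 (λ n x f → n :* (x :* f) := x :* (n :* f)) refl
                       (fromℕ (suc k)) x (F (suc k))) ⟫

  D-X∙ : ∀ F → D (X∙ F) ≋ F +ₛ X∙ (D F)
  D-X∙ F = ⟪ (λ { zero    → trans (*-congʳ (+-identityʳ 1#)) (trans (*-identityˡ _) (sym (+-identityʳ _)))
                ; (suc k) → trans (distribʳ _ _ _) (+-congʳ (*-identityˡ _)) }) ⟫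

  coeff-′ : ∀ p → coeff (p ′) ≋ D (coeff p)
  coeff-′ []      = ⟪ (λ k → sym (zeroʳ _)) ⟫
  coeff-′ (x ∷ p) = begin
    coeff (p +ₚ (0# ∷ p ′))               ≈⟨ coeff-+ p (0# ∷ p ′) ⟩
    coeff p +ₛ coeff (0# ∷ p ′)           ≈⟨ 𝕊.+-congˡ ⟪ (λ { zero → refl ; (suc k) → refl }) ⟫ ⟩
    coeff p +ₛ X∙ (coeff (p ′))           ≈⟨ 𝕊.+-congˡ (X∙-cong (coeff-′ p)) ⟩
    coeff p +ₛ X∙ (D (coeff p))           ≈⟨ D-X∙ (coeff p) ⟨
    D (X∙ (coeff p))                      ≈⟨ ⟪ (λ k → refl) ⟫ ⟩
    D (coeff (x ∷ p))                     ∎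
    where open 𝕊.≋-Reasoning

  linear-⊛ : ∀ z F → coeff (linear z) ⊛ F ≋ X∙ F +ₛ (- z) ·ₛ F
  linear-⊛ z F = begin
    coeff (linear z) ⊛ F              ≈⟨ 𝕊.*-congʳ (coeff-linear z) ⟩
    (X -ₛ const z) ⊛ F                ≈⟨ 𝕊.distribʳ F X (-ₛ const z) ⟩
    X ⊛ F +ₛ (-ₛ const z) ⊛ F         ≈⟨ 𝕊.+-cong (X∙≋X* F) (𝕊.trans (·ₛ≋const* (- z) F) (𝕊.*-congʳ (const-neg z))) ⟨
    X∙ F +ₛ (- z) ·ₛ F                ∎
    where open 𝕊.≋-Reasoning

  D-linear-⊛ : ∀ z F → D (coeff (linear z) ⊛ F) ≋ F +ₛ coeff (linear z) ⊛ D F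
  D-linear-⊛ z F = begin
    D (coeff (linear z) ⊛ F)              ≈⟨ D-cong (linear-⊛ z F) ⟩
    D (X∙ F +ₛ (- z) ·ₛ F)                ≈⟨ D-+ (X∙ F) ((- z) ·ₛ F) ⟩
    D (X∙ F) +ₛ D ((- z) ·ₛ F)            ≈⟨ 𝕊.+-cong (D-X∙ F) (D-· (- z) F) ⟩
    F +ₛ X∙ (D F) +ₛ (- z) ·ₛ D F         ≈⟨ 𝕊.+-assoc _ _ _ ⟩
    F +ₛ (X∙ (D F) +ₛ (- z) ·ₛ D F)       ≈⟨ 𝕊.+-congˡ (linear-⊛ z (D F)) ⟨
    F +ₛ coeff (linear z) ⊛ D F           ∎
    where open 𝕊.≋-Reasoning

  coeff-X^-suc : ∀ f → coeff (X^ (suc f)) ≋ X ⊛ coeff (X^ f)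
  coeff-X^-suc f = 𝕊.trans ⟪ (λ { zero → refl ; (suc k) → refl }) ⟫ (X∙≋X* (coeff (X^ f)))

  coeff-X^-1 : ∀ f → coeff (X^ f −1) ≋ coeff (X^ f) -ₛ 1ₛ
  coeff-X^-1 f = 𝕊.trans (coeff-+ (X^ f) (- 1# ∷ []))
    (𝕊.+-congˡ ⟪ (λ { zero → refl ; (suc k) → sym -0#≈0# }) ⟫)

  X^-1-monic : ∀ f .{{_ : NonZero f}} → Monic (X^ f −1) f
  X^-1-monic (suc f) = record
    { leading = trans (tail f) (lead f)
    ; bounded = λ { (suc k) (ℕ.s≤s f<k) → trans (tail k) (high f k f<k) } }
    where
    tail : ∀ k → coeff (X^ f +ₚ []) k ≈ coeff (X^ f) k
    tail k = trans (at (coeff-+ (X^ f) []) k) (+-identityʳ _)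
    lead : ∀ f → coeff (X^ f) f ≈ 1#
    lead zero    = refl
    lead (suc f) = lead f
    high : ∀ f k → f ℕ.< k → coeff (X^ f) k ≈ 0#
    high zero    (suc k) _           = refl
    high (suc f) (suc k) (ℕ.s≤s f<k) = high f k f<k

  -- u + u² X + ⋯ + uᶠ Xᶠ⁻¹
  geom : Carrier → ℕ → Series
  geom u zero    k       = 0#
  geom u (suc f) zero    = u
  geom u (suc f) (suc k) = u * geom u f k

  geom-< : ∀ u f k → k ℕ.< f → geom u f k ≈ u ^ suc k
  geom-< u (suc f) zero    _           = sym (*-identityʳ u)
  geom-< u (suc f) (suc k) (ℕ.s≤s k<f) = *-congˡ (geom-< u f k k<f)

  geom-≥ : ∀ u f k → f ℕ.≤ k → geom u f k ≈ 0#
  geom-≥ u zero    k       _           = refl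
  geom-≥ u (suc f) (suc k) (ℕ.s≤s f≤k) = trans (*-congˡ (geom-≥ u f k f≤k)) (zeroʳ u)

  geom-suc : ∀ u f → geom u (suc f) ≋ const u ⊛ (1ₛ +ₛ X ⊛ geom u f)
  geom-suc u f = 𝕊.trans
    ⟪ (λ { zero    → sym (trans (*-congˡ (+-identityʳ 1#)) (*-identityʳ u))
         ; (suc k) → *-congˡ (sym (+-identityˡ _)) }) ⟫
    (𝕊.trans (·ₛ≋const* u (1ₛ +ₛ X∙ (geom u f)))
             (𝕊.*-congˡ (𝕊.+-congˡ {1ₛ} (X∙≋X* (geom u f)))))

  geom-linear : ∀ {z u} → u * z ≈ 1# → ∀ f →
                geom u f ⊛ (X -ₛ const z) ≋ const (u ^ f) ⊛ coeff (X^ f) -ₛ 1ₛ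
  geom-linear {z} {u} uz≈1 zero    = begin
    0ₛ ⊛ (X -ₛ const z)             ≈⟨ 𝕊.zeroˡ _ ⟩
    0ₛ                              ≈⟨ 𝕊.-‿inverseʳ 1ₛ ⟨
    1ₛ -ₛ 1ₛ                        ≈⟨ 𝕊.+-congʳ (𝕊.trans (𝕊.*-cong const-1 ⟪ (λ { zero → refl ; (suc k) → refl }) ⟫) (𝕊.*-identityˡ 1ₛ)) ⟨
    const 1# ⊛ coeff (X^ 0) -ₛ 1ₛ   ∎
    where open 𝕊.≋-Reasoning
  geom-linear {z} {u} uz≈1 (suc f) = begin
    geom u (suc f) ⊛ (X -ₛ Z)
      ≈⟨ 𝕊.*-congʳ (geom-suc u f) ⟩
    U ⊛ (1ₛ +ₛ X ⊛ G) ⊛ (X -ₛ Z)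
      ≈⟨ 𝕊.solve 4 (λ u z x g → u 𝕊.:* (𝕊.con (+ 1) 𝕊.:+ x 𝕊.:* g) 𝕊.:* (x 𝕊.:- z) 𝕊.:=
                     u 𝕊.:* x 𝕊.:- u 𝕊.:* z 𝕊.:+ u 𝕊.:* x 𝕊.:* (g 𝕊.:* (x 𝕊.:- z))) 𝕊.refl U Z X G ⟩
    U ⊛ X -ₛ U ⊛ Z +ₛ U ⊛ X ⊛ (G ⊛ (X -ₛ Z))
      ≈⟨ 𝕊.+-cong (𝕊.+-congˡ (𝕊.-‿cong UZ≋1)) (𝕊.*-congˡ (geom-linear uz≈1 f)) ⟩
    U ⊛ X -ₛ 1ₛ +ₛ U ⊛ X ⊛ (const (u ^ f) ⊛ coeff (X^ f) -ₛ 1ₛ)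
      ≈⟨ 𝕊.solve 4 (λ u x p y → u 𝕊.:* x 𝕊.:- 𝕊.con (+ 1) 𝕊.:+ u 𝕊.:* x 𝕊.:* (p 𝕊.:* y 𝕊.:- 𝕊.con (+ 1)) 𝕊.:=
                     u 𝕊.:* p 𝕊.:* (x 𝕊.:* y) 𝕊.:- 𝕊.con (+ 1)) 𝕊.refl U X (const (u ^ f)) (coeff (X^ f)) ⟩
    U ⊛ const (u ^ f) ⊛ (X ⊛ coeff (X^ f)) -ₛ 1ₛ
      ≈⟨ 𝕊.+-congʳ (𝕊.*-cong (const-* u (u ^ f)) (coeff-X^-suc f)) ⟨
    const (u ^ suc f) ⊛ coeff (X^ (suc f)) -ₛ 1ₛ ∎
    where
    open 𝕊.≋-Reasoning
    U = const u
    Z = const z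
    G = geom u f
    UZ≋1 : U ⊛ Z ≋ 1ₛ
    UZ≋1 = 𝕊.trans (𝕊.sym (const-* u z)) (𝕊.trans (const-cong uz≈1) const-1)

  *-recip-⊛ : ∀ F (F₀#0 : F 0 # 0#) → F ⊛ recip F F₀#0 ≋ 1ₛ
  *-recip-⊛ F F₀#0 = 𝕊.trans (𝕊.sym (*ₛ≋⊛ F _)) ⟪ *-recip F F₀#0 ⟫

  ⊛-cancelʳ : ∀ {F G H I} → H ⊛ I ≋ 1ₛ → F ⊛ H ≋ G ⊛ H → F ≋ G
  ⊛-cancelʳ {F} {G} {H} {I} HI≋1 FH≋GH = begin
    F              ≈⟨ 𝕊.*-identityʳ F ⟨
    F ⊛ 1ₛ         ≈⟨ 𝕊.*-congˡ HI≋1 ⟨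
    F ⊛ (H ⊛ I)    ≈⟨ 𝕊.*-assoc F H I ⟨
    F ⊛ H ⊛ I      ≈⟨ 𝕊.*-congʳ FH≋GH ⟩
    G ⊛ H ⊛ I      ≈⟨ 𝕊.*-assoc G H I ⟩
    G ⊛ (H ⊛ I)    ≈⟨ 𝕊.*-congˡ HI≋1 ⟩
    G ⊛ 1ₛ         ≈⟨ 𝕊.*-identityʳ G ⟩
    G              ∎
    where open 𝕊.≋-Reasoning

  recip-unique : ∀ {F G} (F₀#0 : F 0 # 0#) → F ⊛ G ≋ 1ₛ → recip F F₀#0 ≋ G
  recip-unique {F} {G} F₀#0 FG≋1 = ⊛-cancelʳ FG≋1
    (𝕊.trans (𝕊.*-comm _ F) (𝕊.trans (*-recip-⊛ F F₀#0) (𝕊.trans (𝕊.sym FG≋1) (𝕊.*-comm F G))))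

  -- If uz = 1 and uᶠ = 1, then (Xᶠ − 1)/(X − z) = u + u² X + ⋯ + uᶠ Xᶠ⁻¹.
  [X^f-1]/linear : ∀ {z u F} f → u * z ≈ 1# → u ^ f ≈ 1# →
                   F ⊛ coeff (linear z) ≋ coeff (X^ f −1) → F ≋ geom u f
  [X^f-1]/linear {z} {u} {F} f uz≈1 u^f≈1 eq = ⊛-cancelʳ (*-recip-⊛ (coeff (linear z)) -z#0) (begin
    F ⊛ coeff (linear z)                      ≈⟨ eq ⟩
    coeff (X^ f −1)                           ≈⟨ coeff-X^-1 f ⟩
    coeff (X^ f) -ₛ 1ₛ                        ≈⟨ 𝕊.+-congʳ (𝕊.trans (𝕊.*-congʳ (𝕊.trans (const-cong u^f≈1) const-1)) (𝕊.*-identityˡ _)) ⟨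
    const (u ^ f) ⊛ coeff (X^ f) -ₛ 1ₛ        ≈⟨ geom-linear uz≈1 f ⟨
    geom u f ⊛ (X -ₛ const z)                 ≈⟨ 𝕊.*-congˡ (coeff-linear z) ⟨
    geom u f ⊛ coeff (linear z)               ∎)
    where
    open 𝕊.≋-Reasoning
    -z#0 : - z # 0#
    -z#0 = *≈1⇒#0 (trans (solve 2 (λ z u → (:- z) :* (:- u) := u :* z) refl z u) uz≈1)

  -- M (∏ (X − zᵢ))′ is the interpolation sum ∑ᵢ M(zᵢ) ∏_{j≠i} (X − zⱼ) modulo
  -- ∏ (X − zᵢ).  Here both sides are multiplied by the cofactor B of
  -- ∏ (X − zᵢ) in Xᶠ − 1, which turns ∏_{j≠i} (X − zⱼ) into
  -- (Xᶠ − 1)/(X − zᵢ), a geometric sum.  Along the induction the linear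
  -- factors split off are moved into B.
  interpolation : ∀ {ℓ} {I : Set ℓ} (z u : I → Carrier) f →
    (∀ i → u i * z i ≈ 1#) → (∀ i → u i ^ f ≈ 1#) → ∀ M (is : List I) B →
    coeff B ⊛ coeff (∏ₚ[ is ] (linear ∘ z)) ≋ coeff (X^ f −1) →
    ∃ λ q → coeff M ⊛ (coeff B ⊛ D (coeff (∏ₚ[ is ] (linear ∘ z)))) ≋
              ∑ₛ[ is ] (λ i → eval M (z i) ·ₛ geom (u i) f) +ₛ coeff q ⊛ coeff (X^ f −1)
  interpolation z u f uz≈1 u^f≈1 M []       B _  = [] , (begin
    coeff M ⊛ (coeff B ⊛ D (coeff (1# ∷ [])))
      ≈⟨ 𝕊.*-congˡ (𝕊.*-congˡ ⟪ (λ k → zeroʳ _) ⟫) ⟩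
    coeff M ⊛ (coeff B ⊛ 0ₛ)
      ≈⟨ 𝕊.solve 3 (λ m b e → m 𝕊.:* (b 𝕊.:* 𝕊.con (+ 0)) 𝕊.:= 𝕊.con (+ 0) 𝕊.:+ 𝕊.con (+ 0) 𝕊.:* e) 𝕊.refl
           (coeff M) (coeff B) (coeff (X^ f −1)) ⟩
    0ₛ +ₛ 0ₛ ⊛ coeff (X^ f −1)
      ≈⟨ 𝕊.+-congˡ (𝕊.*-congʳ coeff-[]) ⟨
    0ₛ +ₛ coeff [] ⊛ coeff (X^ f −1) ∎)
    where open 𝕊.≋-Reasoning
  interpolation z u f uz≈1 u^f≈1 M (i ∷ is) B BΠ≋E =
    (q₁ +ₚ q₂) , (begin
    m ⊛ (b ⊛ D (coeff (linear (z i) *ₚ Π)))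
      ≈⟨ 𝕊.*-congˡ (𝕊.*-congˡ (𝕊.trans (D-cong (coeff-* (linear (z i)) Π)) (D-linear-⊛ (z i) π))) ⟩
    m ⊛ (b ⊛ (π +ₛ l ⊛ D π))
      ≈⟨ 𝕊.solve 5 (λ m b p l d → m 𝕊.:* (b 𝕊.:* (p 𝕊.:+ l 𝕊.:* d)) 𝕊.:=
                       m 𝕊.:* (b 𝕊.:* p) 𝕊.:+ m 𝕊.:* ((b 𝕊.:* l) 𝕊.:* d)) 𝕊.refl m b π l (D π) ⟩
    m ⊛ (b ⊛ π) +ₛ m ⊛ ((b ⊛ l) ⊛ D π)
      ≈⟨ 𝕊.+-cong (𝕊.*-congʳ M≋) (𝕊.*-congˡ (𝕊.*-congʳ (𝕊.sym (coeff-* B (linear (z i)))))) ⟩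
    (const y +ₛ coeff q₁ ⊛ l) ⊛ (b ⊛ π) +ₛ m ⊛ (coeff (B *ₚ linear (z i)) ⊛ D π)
      ≈⟨ 𝕊.+-cong (𝕊.solve 5 (λ y q l b p → (y 𝕊.:+ q 𝕊.:* l) 𝕊.:* (b 𝕊.:* p) 𝕊.:=
                       y 𝕊.:* (b 𝕊.:* p) 𝕊.:+ q 𝕊.:* (b 𝕊.:* (l 𝕊.:* p))) 𝕊.refl (const y) (coeff q₁) l b π)
                  IH≋ ⟩
    const y ⊛ (b ⊛ π) +ₛ coeff q₁ ⊛ (b ⊛ (l ⊛ π)) +ₛ (S +ₛ coeff q₂ ⊛ E)
      ≈⟨ 𝕊.+-congʳ (𝕊.+-cong
           (𝕊.trans (𝕊.*-congˡ bπ≋geom) (𝕊.sym (·ₛ≋const* y (geom (u i) f))))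
           (𝕊.*-congˡ blπ≋E)) ⟩
    y ·ₛ geom (u i) f +ₛ coeff q₁ ⊛ E +ₛ (S +ₛ coeff q₂ ⊛ E)
      ≈⟨ 𝕊.solve 5 (λ a q s r e → a 𝕊.:+ q 𝕊.:* e 𝕊.:+ (s 𝕊.:+ r 𝕊.:* e) 𝕊.:= a 𝕊.:+ s 𝕊.:+ (q 𝕊.:+ r) 𝕊.:* e) 𝕊.refl
           (y ·ₛ geom (u i) f) (coeff q₁) S (coeff q₂) E ⟩
    y ·ₛ geom (u i) f +ₛ S +ₛ (coeff q₁ +ₛ coeff q₂) ⊛ E
      ≈⟨ 𝕊.+-congˡ (𝕊.*-congʳ (coeff-+ q₁ q₂)) ⟨
    y ·ₛ geom (u i) f +ₛ S +ₛ coeff (q₁ +ₚ q₂) ⊛ E ∎)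
    where
    open 𝕊.≋-Reasoning
    Π = ∏ₚ[ is ] (linear ∘ z)
    m = coeff M
    b = coeff B
    π = coeff Π
    l = coeff (linear (z i))
    E = coeff (X^ f −1)
    S = ∑ₛ[ is ] (λ i → eval M (z i) ·ₛ geom (u i) f)
    y = eval M (z i)
    q₁ = proj₁ (factor-theorem M (z i))
    M≋ = proj₂ (factor-theorem M (z i))
    blπ≋E : b ⊛ (l ⊛ π) ≋ E
    blπ≋E = 𝕊.trans (𝕊.*-congˡ (𝕊.sym (coeff-* (linear (z i)) Π))) BΠ≋E
    [bl]π≋E : coeff (B *ₚ linear (z i)) ⊛ π ≋ E
    [bl]π≋E = 𝕊.trans (𝕊.*-congʳ (coeff-* B (linear (z i)))) (𝕊.trans (𝕊.*-assoc b l π) blπ≋E)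
    IH = interpolation z u f uz≈1 u^f≈1 M is (B *ₚ linear (z i)) [bl]π≋E
    q₂ = proj₁ IH
    IH≋ = proj₂ IH
    bπ≋geom : b ⊛ π ≋ geom (u i) f
    bπ≋geom = [X^f-1]/linear f (uz≈1 i) (u^f≈1 i)
      (𝕊.trans (𝕊.solve 3 (λ b p l → b 𝕊.:* p 𝕊.:* l 𝕊.:= b 𝕊.:* (l 𝕊.:* p)) 𝕊.refl b π l) blπ≋E)

  -- Finite sums

  -- The sum over a list, with the meaning of ∏[_] for products
  ∑[_] : ∀ {ℓ} {I : Set ℓ} → List I → (I → Carrier) → Carrier
  ∑[ is ] h = List.foldr _+_ 0# (List.map h is)

  ∑-cong : ∀ {ℓ} {I : Set ℓ} (is : List I) {h h′ : I → Carrier} →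
           (∀ i → h i ≈ h′ i) → ∑[ is ] h ≈ ∑[ is ] h′
  ∑-cong []       h≈h′ = refl
  ∑-cong (i ∷ is) h≈h′ = +-cong (h≈h′ i) (∑-cong is h≈h′)

  *-distribˡ-∑ : ∀ {ℓ} {I : Set ℓ} (is : List I) x (h : I → Carrier) →
                 ∑[ is ] (λ i → x * h i) ≈ x * ∑[ is ] h
  *-distribˡ-∑ []       x h = sym (zeroʳ x)
  *-distribˡ-∑ (i ∷ is) x h = trans (+-congˡ (*-distribˡ-∑ is x h)) (sym (distribˡ _ _ _))

  ∑-sum-comm : ∀ {ℓ} {I : Set ℓ} (is : List I) n (h : I → Fin n → Carrier) →
               ∑[ is ] (λ i → sum (h i)) ≈ sum (λ m → ∑[ is ] (λ i → h i m))
  ∑-sum-comm []       n h = sym (sum-replicate-zero n)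
  ∑-sum-comm (i ∷ is) n h = trans (+-congˡ (∑-sum-comm is n h)) (sym (∑-distrib-+ (h i) _))

  ∑ₛ-at : ∀ {ℓ} {I : Set ℓ} (is : List I) (h : I → Series) k →
          (∑ₛ[ is ] h) k ≈ ∑[ is ] (λ i → h i k)
  ∑ₛ-at []       h k = refl
  ∑ₛ-at (i ∷ is) h k = +-congˡ (∑ₛ-at is h k)

  ∏-linear-root : ∀ {ℓ} {I : Set ℓ} (z : I → Carrier) {is : List I} {y} →
                  Any (λ i → y ≈ z i) is → eval (∏ₚ[ is ] (linear ∘ z)) y ≈ 0#
  ∏-linear-root z {i ∷ is} {y} (here y≈zᵢ) = trans (eval-* (linear (z i)) (∏ₚ[ is ] (linear ∘ z)) y) (trans
    (*-congʳ (trans (eval-linear (z i) y) (trans (+-congʳ y≈zᵢ) (-‿inverseʳ (z i))))) (zeroˡ _))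
  ∏-linear-root z {i ∷ is} {y} (there y∈)  = trans (eval-* (linear (z i)) (∏ₚ[ is ] (linear ∘ z)) y) (trans
    (*-congˡ (∏-linear-root z y∈)) (zeroʳ _))

  -- Primitive roots of unity

  module _ {f : ℕ} .{{_ : NonTrivial f}} where

    private instance
      f≢0 : NonZero f
      f≢0 = ℕ.nonTrivial⇒nonZero f

    -- ζ⁻¹
    value⁻¹ : PrimitiveRoot f → Carrier
    value⁻¹ ζ = inv (root#0 ζ)

    value⁻¹^f : ∀ ζ → value⁻¹ ζ ^ f ≈ 1#
    value⁻¹^f ζ = begin
      value⁻¹ ζ ^ f                     ≈⟨ *-identityʳ _ ⟨
      value⁻¹ ζ ^ f * 1#                ≈⟨ *-congˡ (isRoot ζ) ⟨
      value⁻¹ ζ ^ f * value ζ ^ f       ≈⟨ CommExp.^-distrib-* _ _ f ⟨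
      (value⁻¹ ζ * value ζ) ^ f         ≈⟨ Exp.^-congˡ f (*-invˡ (root#0 ζ)) ⟩
      1# ^ f                            ≈⟨ 1^ f ⟩
      1#                                ∎
      where open ≈-Reasoning

    ^[k*f]≈1 : ∀ {x} → x ^ f ≈ 1# → ∀ k → x ^ (k ℕ.* f) ≈ 1#
    ^[k*f]≈1 {x} x^f≈1 k = begin
      x ^ (k ℕ.* f)   ≡⟨ ≡.cong (x ^_) (ℕₚ.*-comm k f) ⟩
      x ^ (f ℕ.* k)   ≈⟨ Exp.^-assocʳ x f k ⟨
      (x ^ f) ^ k     ≈⟨ Exp.^-congˡ k x^f≈1 ⟩
      1# ^ k          ≈⟨ 1^ k ⟩
      1#              ∎
      where open ≈-Reasoning

    ^-mod : ∀ {x} → x ^ f ≈ 1# → ∀ m k → x ^ (m ℕ.+ k ℕ.* f) ≈ x ^ m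
    ^-mod {x} x^f≈1 m k = trans (Exp.^-homo-* x m (k ℕ.* f))
      (trans (*-congˡ (^[k*f]≈1 x^f≈1 k)) (*-identityʳ _))

    -- ζ⁻ᵗ depends only on the residue of t modulo f.
    root^-neg : ∀ ζ (t : ℤ) m → t ≡ + m [mod f ] → root^_ ζ (ℤ.- t) ≈ value⁻¹ ζ ^ m
    root^-neg ζ (+ t) m (divides k |t-m|≡kf) = trans (root^-neg-pos t) (cases (ℕₚ.≤-total m t))
      where
      root^-neg-pos : ∀ t → root^_ ζ (ℤ.- (+ t)) ≈ value⁻¹ ζ ^ t
      root^-neg-pos zero    = refl
      root^-neg-pos (suc t) = refl
      |t⊖m|≡kf : ℤ.∣ t ℤ.⊖ m ∣ ≡ k ℕ.* f
      |t⊖m|≡kf = ≡.trans (≡.sym (≡.cong ℤ.∣_∣ (ℤₚ.m-n≡m⊖n t m))) |t-m|≡kf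
      m+kf : ∀ {m t} → m ℕ.≤ t → t ℕ.∸ m ≡ k ℕ.* f → value⁻¹ ζ ^ t ≈ value⁻¹ ζ ^ m
      m+kf {m} m≤t t∸m≡kf = trans
        (Exp.^-congʳ _ (≡.trans (≡.sym (ℕₚ.m+[n∸m]≡n m≤t)) (≡.cong (m ℕ.+_) t∸m≡kf)))
        (^-mod (value⁻¹^f ζ) m k)
      cases : m ℕ.≤ t ⊎ t ℕ.≤ m → value⁻¹ ζ ^ t ≈ value⁻¹ ζ ^ m
      cases (inj₁ m≤t) = m+kf m≤t
        (≡.trans (≡.sym (≡.trans (ℤₚ.∣m⊖n∣≡∣n⊖m∣ t m) (ℤₚ.∣⊖∣-≤ m≤t))) |t⊖m|≡kf)
      cases (inj₂ t≤m) = sym (m+kf t≤m (≡.trans (≡.sym (ℤₚ.∣⊖∣-≤ t≤m)) |t⊖m|≡kf))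
    root^-neg ζ -[1+ t ] m (divides k |t-m|≡kf) = begin
      z ^ suc t                          ≈⟨ *-identityʳ _ ⟨
      z ^ suc t * 1#                     ≈⟨ *-congˡ (^[k*f]≈1 (value⁻¹^f ζ) k) ⟨
      z ^ suc t * u ^ (k ℕ.* f)          ≡⟨ ≡.cong (λ j → z ^ suc t * u ^ j) (≡.trans (≡.sym |t-m|≡kf) (abs m)) ⟩
      z ^ suc t * u ^ (suc t ℕ.+ m)      ≈⟨ *-congˡ (Exp.^-homo-* u (suc t) m) ⟩
      z ^ suc t * (u ^ suc t * u ^ m)    ≈⟨ *-assoc _ _ _ ⟨
      z ^ suc t * u ^ suc t * u ^ m      ≈⟨ *-congʳ (CommExp.^-distrib-* z u (suc t)) ⟨
      (z * u) ^ suc t * u ^ m            ≈⟨ *-congʳ (trans (Exp.^-congˡ (suc t) (*-inv (root#0 ζ))) (1^ (suc t))) ⟩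
      1# * u ^ m                         ≈⟨ *-identityˡ _ ⟩
      u ^ m                              ∎
      where
      open ≈-Reasoning
      z = value ζ
      u = value⁻¹ ζ
      abs : ∀ m → ℤ.∣ -[1+ t ] ℤ.- + m ∣ ≡ suc t ℕ.+ m
      abs zero    = ≡.sym (ℕₚ.+-identityʳ (suc t))
      abs (suc m) = ≡.cong suc (≡.sym (ℕₚ.+-suc t m))

  -- The cyclotomic polynomial

  module CyclotomicProperties {f : ℕ} .{{_ : NonTrivial f}} (𝒫 : PrimitiveRoots f) where

    open Cyclotomic 𝒫

    private instance
      f≢0 : NonZero f
      f≢0 = ℕ.nonTrivial⇒nonZero f

    Φ-root : ∀ ζ → eval Φ (value ζ) ≈ 0#
    Φ-root ζ = ∏-linear-root value (complete ζ)

    eval-⟨⟩R : ∀ p ζ → eval ⟨ p ⟩R (value ζ) ≈ eval p (value ζ)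
    eval-⟨⟩R p ζ = sym (begin
      eval p z                            ≈⟨ eval-cong {p} {r +ₚ q *ₚ Φ} ⟪ divMod-correct Φ degΦ p ⟫ z ⟩
      eval (r +ₚ q *ₚ Φ) z                ≈⟨ eval-+ r (q *ₚ Φ) z ⟩
      eval r z + eval (q *ₚ Φ) z          ≈⟨ +-congˡ (eval-* q Φ z) ⟩
      eval r z + eval q z * eval Φ z      ≈⟨ +-congˡ (trans (*-congˡ (Φ-root ζ)) (zeroʳ _)) ⟩
      eval r z + 0#                       ≈⟨ +-identityʳ _ ⟩
      eval r z                            ∎)
      where
      open ≈-Reasoning
      z = value ζ
      q = proj₁ (divMod Φ degΦ p)
      r = ⟨ p ⟩R

    -- Φ has pairwise apart roots, all of them f-th roots of unity, so it
    -- divides Xᶠ − 1.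
    Φ̂⊛Φ : coeff Φ̂ ⊛ coeff Φ ≋ coeff (X^ f −1)
    Φ̂⊛Φ = begin
      coeff Φ̂ ⊛ coeff Φ                 ≈⟨ 𝕊.+-identityˡ _ ⟨
      0ₛ +ₛ coeff Φ̂ ⊛ coeff Φ           ≈⟨ 𝕊.+-congʳ r≋0 ⟨
      coeff r +ₛ coeff Φ̂ ⊛ coeff Φ      ≈⟨ division ⟨
      coeff (X^ f −1)                   ∎
      where
      open 𝕊.≋-Reasoning
      r = ⟨ X^ f −1 ⟩R
      division : coeff (X^ f −1) ≋ coeff r +ₛ coeff Φ̂ ⊛ coeff Φ
      division = 𝕊.trans ⟪ divMod-correct Φ degΦ (X^ f −1) ⟫
        (𝕊.trans (coeff-+ r (Φ̂ *ₚ Φ)) (𝕊.+-congˡ (coeff-* Φ̂ Φ)))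
      r-root : ∀ ζ → eval r (value ζ) ≈ 0#
      r-root ζ = trans (eval-⟨⟩R (X^ f −1) ζ)
        (trans (eval-X^-1 f (value ζ)) (trans (+-congʳ (isRoot ζ)) (-‿inverseʳ 1#)))
      multiple = roots⇒multiple value distinct r (All.universal r-root roots)
      q≋0 : coeff (proj₁ multiple) ≋ 0ₛ
      q≋0 = monic-multiple Φ-monic (proj₁ multiple) λ k degΦ≤k →
        trans (sym (at (proj₂ multiple) k)) (⟨⟩R-degree (X^ f −1) k degΦ≤k)
      r≋0 : coeff r ≋ 0ₛ
      r≋0 = 𝕊.trans (proj₂ multiple) (𝕊.trans (𝕊.*-congʳ q≋0) (𝕊.zeroˡ _))

    -- The coefficients of M Φ̂ Φ′ modulo Xᶠ − 1, as values of a discrete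
    -- Fourier transform
    coefficients-as-sums : ∀ M (c : Fin f → Carrier) →
      M *ₚ Φ̂ *ₚ Φ ′ ≡ₚ tabulate c [mod X^ f −1 ] →
      ∀ i → c i ≈ ∑[ roots ] (λ ζ → eval M (value ζ) * value⁻¹ ζ ^ suc (toℕ i))
    coefficients-as-sums M c (q , MΦ̂Φ′≈) i = begin
      c i                                    ≈⟨ tabulate-< c i ⟨
      coeff (tabulate c) (toℕ i)             ≈⟨ at c≋S (toℕ i) ⟩
      S (toℕ i)                              ≈⟨ ∑ₛ-at roots _ (toℕ i) ⟩
      ∑[ roots ] (λ ζ → eval M (value ζ) * geom (value⁻¹ ζ) f (toℕ i))
        ≈⟨ ∑-cong roots (λ ζ → *-congˡ (geom-< (value⁻¹ ζ) f (toℕ i) (Finₚ.toℕ<n i))) ⟩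
      ∑[ roots ] (λ ζ → eval M (value ζ) * value⁻¹ ζ ^ suc (toℕ i)) ∎
      where
      open ≈-Reasoning
      E = coeff (X^ f −1)
      S = ∑ₛ[ roots ] (λ ζ → eval M (value ζ) ·ₛ geom (value⁻¹ ζ) f)
      interp = interpolation value value⁻¹ f (λ ζ → *-invˡ (root#0 ζ)) value⁻¹^f M roots Φ̂ Φ̂⊛Φ
      r = proj₁ interp
      tabulate-< : ∀ {n} (c : Fin n → Carrier) i → coeff (tabulate c) (toℕ i) ≈ c i
      tabulate-< c Fin.zero    = refl
      tabulate-< c (Fin.suc i) = tabulate-< (c ∘ Fin.suc) i
      tabulate-≥ : ∀ {n} (c : Fin n → Carrier) k → n ℕ.≤ k → coeff (tabulate c) k ≈ 0#
      tabulate-≥ {zero}  c k       _           = refl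
      tabulate-≥ {suc n} c (suc k) (ℕ.s≤s n≤k) = tabulate-≥ (c ∘ Fin.suc) k n≤k
      ∑-≥ : ∀ (ζs : List (PrimitiveRoot f)) k → f ℕ.≤ k → (∑ₛ[ ζs ] (λ ζ → eval M (value ζ) ·ₛ geom (value⁻¹ ζ) f)) k ≈ 0#
      ∑-≥ []       k f≤k = refl
      ∑-≥ (ζ ∷ ζs) k f≤k = trans
        (+-cong (trans (*-congˡ (geom-≥ (value⁻¹ ζ) f k f≤k)) (zeroʳ _)) (∑-≥ ζs k f≤k)) (+-identityʳ 0#)
      congruent : coeff (tabulate c) +ₛ coeff q ⊛ E ≋ S +ₛ coeff r ⊛ E
      congruent = 𝕊.trans (𝕊.sym (𝕊.trans (coeff-+ (tabulate c) (q *ₚ X^ f −1)) (𝕊.+-congˡ (coeff-* q (X^ f −1)))))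
        (𝕊.trans ⟪ (λ k → sym (MΦ̂Φ′≈ k)) ⟫
        (𝕊.trans (𝕊.trans (coeff-* (M *ₚ Φ̂) (Φ ′)) (𝕊.*-cong (coeff-* M Φ̂) (coeff-′ Φ)))
        (𝕊.trans (𝕊.*-assoc (coeff M) (coeff Φ̂) (D (coeff Φ))) (proj₂ interp))))
      -- d (Xᶠ − 1) has degree below f, being the difference of two
      -- polynomials that do, so d = 0.
      d = r +ₚ (- 1#) ·ₚ q
      coeff-d : coeff d ≋ coeff r -ₛ coeff q
      coeff-d = 𝕊.trans (coeff-+ r ((- 1#) ·ₚ q)) (𝕊.+-congˡ (𝕊.trans (coeff-· (- 1#) q)
        ⟪ (λ k → trans (sym (-‿distribˡ-* 1# _)) (-‿cong (*-identityˡ _))) ⟫))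
      difference : coeff d ⊛ E ≋ coeff (tabulate c) -ₛ S
      difference = 𝕊.trans (𝕊.*-congʳ coeff-d) (𝕊.trans
        (𝕊.solve 4 (λ r q e s → (r 𝕊.:- q) 𝕊.:* e 𝕊.:= (s 𝕊.:+ r 𝕊.:* e) 𝕊.:- q 𝕊.:* e 𝕊.:- s)
           𝕊.refl (coeff r) (coeff q) E S)
        (𝕊.trans (𝕊.+-congʳ (𝕊.+-congʳ (𝕊.sym congruent)))
        (𝕊.solve 4 (λ t q e s → (t 𝕊.:+ q 𝕊.:* e) 𝕊.:- q 𝕊.:* e 𝕊.:- s 𝕊.:= t 𝕊.:- s)
           𝕊.refl (coeff (tabulate c)) (coeff q) E S)))
      d≋0 : coeff d ≋ 0ₛ
      d≋0 = monic-multiple (X^-1-monic f) d λ k f≤k → trans (at difference k)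
        (trans (+-cong (tabulate-≥ c k f≤k) (-‿cong (∑-≥ roots k f≤k))) (-‿inverseʳ 0#))
      c≋S : coeff (tabulate c) ≋ S
      c≋S = ⟪ (λ k → x∙y⁻¹≈ε⇒x≈y _ _ (trans (sym (at difference k))
        (trans (at (𝕊.*-congʳ {E} d≋0) k) (at (𝕊.zeroˡ E) k)))) ⟫

  -- Dilations F(xs)

  ⟨s⟩-⊛ : ∀ x F G → (F ⊛ G) ⟨ x s⟩ ≋ F ⟨ x s⟩ ⊛ G ⟨ x s⟩
  ⟨s⟩-⊛ x F G = ⟪ go F ⟫
    where
    open ≈-Reasoning
    go : ∀ F k → x ^ k * (F ⊛ G) k ≈ (F ⟨ x s⟩ ⊛ G ⟨ x s⟩) k
    go F zero    = begin
      1# * (F ⊛ G) 0                  ≈⟨ *-congˡ (⊛-zero F G) ⟩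
      1# * (F 0 * G 0)                ≈⟨ solve 2 (λ f g → con (+ 1) :* (f :* g) := con (+ 1) :* f :* (con (+ 1) :* g)) refl (F 0) (G 0) ⟩
      1# * F 0 * (1# * G 0)           ≈⟨ ⊛-zero (F ⟨ x s⟩) (G ⟨ x s⟩) ⟨
      (F ⟨ x s⟩ ⊛ G ⟨ x s⟩) 0         ∎
    go F (suc k) = begin
      x ^ suc k * (F ⊛ G) (suc k)
        ≈⟨ *-congˡ (⊛-suc F G k) ⟩
      x * x ^ k * (F 0 * G (suc k) + ((F ∘ suc) ⊛ G) k)
        ≈⟨ solve 5 (λ x p f g h → x :* p :* (f :* g :+ h) := con (+ 1) :* f :* (x :* p :* g) :+ x :* (p :* h)) refl
             x (x ^ k) (F 0) (G (suc k)) (((F ∘ suc) ⊛ G) k) ⟩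
      1# * F 0 * (x * x ^ k * G (suc k)) + x * (x ^ k * ((F ∘ suc) ⊛ G) k)
        ≈⟨ +-congˡ (*-congˡ (go (F ∘ suc) k)) ⟩
      1# * F 0 * (x * x ^ k * G (suc k)) + x * ((F ∘ suc) ⟨ x s⟩ ⊛ G ⟨ x s⟩) k
        ≈⟨ +-congˡ (at (·ₛ-⊛-assoc x ((F ∘ suc) ⟨ x s⟩) (G ⟨ x s⟩)) k) ⟨
      1# * F 0 * (x * x ^ k * G (suc k)) + ((x ·ₛ (F ∘ suc) ⟨ x s⟩) ⊛ G ⟨ x s⟩) k
        ≈⟨ +-congˡ (at (𝕊.*-congʳ {G ⟨ x s⟩} ⟪ (λ j → *-assoc x (x ^ j) (F (suc j))) ⟫) k) ⟨
      1# * F 0 * (x * x ^ k * G (suc k)) + (((F ⟨ x s⟩) ∘ suc) ⊛ G ⟨ x s⟩) k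
        ≈⟨ ⊛-suc (F ⟨ x s⟩) (G ⟨ x s⟩) k ⟨
      (F ⟨ x s⟩ ⊛ G ⟨ x s⟩) (suc k) ∎

  x^k*1ₛ : ∀ x k → x ^ k * 1ₛ k ≈ 1ₛ k
  x^k*1ₛ x zero    = *-identityˡ 1#
  x^k*1ₛ x (suc k) = zeroʳ _

  ⟨s⟩-inverse : ∀ x {F G} → F ⊛ G ≋ 1ₛ → F ⟨ x s⟩ ⊛ G ⟨ x s⟩ ≋ 1ₛ
  ⟨s⟩-inverse x {F} {G} FG≋1 = 𝕊.trans (𝕊.sym (⟨s⟩-⊛ x F G))
    ⟪ (λ k → trans (*-congˡ (at FG≋1 k)) (x^k*1ₛ x k)) ⟫

  ·ₛ-⊛-·ₛ : ∀ x F y G → (x ·ₛ F) ⊛ (y ·ₛ G) ≋ (x * y) ·ₛ (F ⊛ G)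
  ·ₛ-⊛-·ₛ x F y G = begin
    (x ·ₛ F) ⊛ (y ·ₛ G)                 ≈⟨ 𝕊.*-cong (·ₛ≋const* x F) (·ₛ≋const* y G) ⟩
    (const x ⊛ F) ⊛ (const y ⊛ G)       ≈⟨ 𝕊.solve 4 (λ x f y g → (x 𝕊.:* f) 𝕊.:* (y 𝕊.:* g) 𝕊.:= (x 𝕊.:* y) 𝕊.:* (f 𝕊.:* g)) 𝕊.refl (const x) F (const y) G ⟩
    (const x ⊛ const y) ⊛ (F ⊛ G)       ≈⟨ 𝕊.*-congʳ (const-* x y) ⟨
    const (x * y) ⊛ (F ⊛ G)             ≈⟨ ·ₛ≋const* (x * y) (F ⊛ G) ⟨
    (x * y) ·ₛ (F ⊛ G)                  ∎
    where open 𝕊.≋-Reasoning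

  -- The inverses of the factors

  -- θ as a geometric sum; eval-θ′ is the same for its derivative.
  eval-θ : ∀ w n → (1# - w) * eval (replicate n 1#) w ≈ 1# - w ^ n
  eval-θ w zero    = trans (zeroʳ _) (sym (-‿inverseʳ 1#))
  eval-θ w (suc n) = begin
    (1# - w) * (1# + w * T)            ≈⟨ solve 2 (λ w t → (con (+ 1) :- w) :* (con (+ 1) :+ w :* t) := con (+ 1) :- w :+ w :* ((con (+ 1) :- w) :* t)) refl w T ⟩
    1# - w + w * ((1# - w) * T)        ≈⟨ +-congˡ (*-congˡ (eval-θ w n)) ⟩
    1# - w + w * (1# - w ^ n)          ≈⟨ solve 2 (λ w p → con (+ 1) :- w :+ w :* (con (+ 1) :- p) := con (+ 1) :- w :* p) refl w (w ^ n) ⟩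
    1# - w * w ^ n                     ∎
    where
    open ≈-Reasoning
    T = eval (replicate n 1#) w

  eval-θ′ : ∀ w n → (1# - w) * (w * eval (replicate n 1# ′) w) ≈
                    w * eval (replicate n 1#) w - fromℕ n * w ^ n
  eval-θ′ w zero    = solve 1 (λ w → (con (+ 1) :- w) :* (w :* con (+ 0)) := w :* con (+ 0) :- con (+ 0) :* con (+ 1)) refl w
  eval-θ′ w (suc n) = begin
    (1# - w) * (w * eval (replicate n 1# +ₚ (0# ∷ replicate n 1# ′)) w)
      ≈⟨ *-congˡ (*-congˡ (eval-+ (replicate n 1#) (0# ∷ replicate n 1# ′) w)) ⟩
    (1# - w) * (w * (T + (0# + w * T′)))
      ≈⟨ solve 3 (λ w t d → (con (+ 1) :- w) :* (w :* (t :+ (con (+ 0) :+ w :* d))) := w :* ((con (+ 1) :- w) :* t) :+ w :* ((con (+ 1) :- w) :* (w :* d))) refl w T T′ ⟩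
    w * ((1# - w) * T) + w * ((1# - w) * (w * T′))
      ≈⟨ +-cong (*-congˡ (eval-θ w n)) (*-congˡ (eval-θ′ w n)) ⟩
    w * (1# - w ^ n) + w * (w * T - fromℕ n * w ^ n)
      ≈⟨ solve 4 (λ w t n p → w :* (con (+ 1) :- p) :+ w :* (w :* t :- n :* p) := w :* (con (+ 1) :+ w :* t) :- (con (+ 1) :+ n) :* (w :* p)) refl w T (fromℕ n) (w ^ n) ⟩
    w * (1# + w * T) - fromℕ (suc n) * (w * w ^ n) ∎
    where
    open ≈-Reasoning
    T = eval (replicate n 1#) w
    T′ = eval (replicate n 1# ′) w

  -- The order is passed through an equation because that of a factor is
  -- determined by a case distinction.
  series-1/ₗ : ∀ F {d} (ord : HasOrder F d) {e G} → d ≡ e →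
               (λ k → F (k ℕ.+ e)) ⊛ G ≋ 1ₛ → series (1/ₗ F ord) ≋ G
  series-1/ₗ F ord ≡.refl FG≋1 = recip-unique (HasOrder.leading ord) FG≋1

  exp₀≈1 : ∀ x → exp x 0 ≈ 1#
  exp₀≈1 x = trans (*-identityˡ _) (1/1≈1 1 ≡.refl)

  module FactorProperties {f : ℕ} .{{_ : NonTrivial f}} (𝒫 : PrimitiveRoots f) (ζ : PrimitiveRoot f) where

    open Cyclotomic 𝒫
    open CyclotomicProperties 𝒫

    private
      instance
        f≢0 : NonZero f
        f≢0 = ℕ.nonTrivial⇒nonZero f

      z = value ζ

    factor-order-∣ : ∀ {a} → f ∣ a → factor-order ζ a ≡ 1
    factor-order-∣ {a} f∣a with f ∣? a
    ... | yes _   = ≡.refl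
    ... | no  f∤a = contradiction f∣a f∤a

    factor-order-∤ : ∀ {a} → f ∤ a → factor-order ζ a ≡ 0
    factor-order-∤ {a} f∤a with f ∣? a
    ... | yes f∣a = contradiction f∣a f∤a
    ... | no  _   = ≡.refl

    -- 1 − ζᵃ eᵃˢ = − as · (eᵃˢ − 1)/(as)
    series-1/factor-∣ : ∀ a .{{_ : NonZero a}} → f ∣ a →
      series (1/ₗ (factor ζ a) (factor-hasOrder ζ a)) ≋ (- 1/ℕ a) ·ₛ g ⟨ fromℕ a s⟩
    series-1/factor-∣ a f∣a@(divides k a≡kf) = series-1/ₗ (factor ζ a) (factor-hasOrder ζ a) (factor-order-∣ f∣a) (begin
      (λ k → factor ζ a (k ℕ.+ 1)) ⊛ ((- 1/ℕ a) ·ₛ g ⟨ A s⟩)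
        ≈⟨ 𝕊.*-congʳ ⟪ shifted ⟫ ⟩
      ((- A) ·ₛ (expm1 ∘ suc) ⟨ A s⟩) ⊛ ((- 1/ℕ a) ·ₛ g ⟨ A s⟩)
        ≈⟨ ·ₛ-⊛-·ₛ (- A) ((expm1 ∘ suc) ⟨ A s⟩) (- 1/ℕ a) (g ⟨ A s⟩) ⟩
      (- A * - 1/ℕ a) ·ₛ ((expm1 ∘ suc) ⟨ A s⟩ ⊛ g ⟨ A s⟩)
        ≈⟨ ·ₛ-cong (trans (solve 2 (λ x y → (:- x) :* (:- y) := x :* y) refl A (1/ℕ a)) (*-inv (fromℕ#0 a)))
                   (⟨s⟩-inverse A (*-recip-⊛ (expm1 ∘ suc) _)) ⟩
      const 1#
        ≈⟨ const-1 ⟩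
      1ₛ ∎)
      where
      open 𝕊.≋-Reasoning
      A = fromℕ a
      z^a≈1 : z ^ a ≈ 1#
      z^a≈1 = trans (Exp.^-congʳ z a≡kf) (^[k*f]≈1 (isRoot ζ) k)
      step : ∀ k → factor ζ a (suc k) ≈ - A * (A ^ k * expm1 (suc k))
      step k = trans (+-congˡ (-‿cong (*-congʳ z^a≈1)))
        (trans (solve 3 (λ A p r → con (+ 0) :- con (+ 1) :* (A :* p :* r) := :- A :* (p :* (con (+ 1) :* r :- con (+ 0)))) refl A (A ^ k) _)
               (*-congˡ (*-congˡ (+-congʳ (*-congʳ (sym (1^ (suc k))))))))
      shifted : ∀ k → factor ζ a (k ℕ.+ 1) ≈ - A * (A ^ k * expm1 (suc k))
      shifted k = trans (reflexive (≡.cong (factor ζ a) (ℕₚ.+-comm k 1))) (step k)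

    -- 1 − ζᵃ is the leading coefficient of a factor of order 0.
    1-ζ^a#0 : ∀ a .{{_ : NonZero a}} → f ∤ a → 1# - z ^ a # 0#
    1-ζ^a#0 a f∤a = Apart.#-congʳ
      (+-congˡ (-‿cong (trans (*-congˡ (exp₀≈1 (fromℕ a))) (*-identityʳ _))))
      (leading (factor-hasOrder ζ a) (factor-order-∤ f∤a))
      where
      leading : ∀ {F d} → HasOrder F d → d ≡ 0 → F 0 # 0#
      leading ord ≡.refl = HasOrder.leading ord

    -- v(ζ) = 1/(1 − ζᵃ), since (1 − w) w θ′(w) = − f for an f-th root of
    -- unity w apart from 1.
    v-inverse : ∀ a .{{_ : NonZero a}} → f ∤ a → (1# - z ^ a) * eval (v a) z ≈ 1#
    v-inverse a f∤a = begin
      (1# - w) * eval (v a) z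
        ≈⟨ *-congˡ (eval-⟨⟩R ((- 1/ℕ f) ·ₚ (X^ a *ₚ (θ ′ ∘ₚ X^ a))) ζ) ⟩
      (1# - w) * eval ((- 1/ℕ f) ·ₚ (X^ a *ₚ (θ ′ ∘ₚ X^ a))) z
        ≈⟨ *-congˡ (trans (eval-· (- 1/ℕ f) (X^ a *ₚ (θ ′ ∘ₚ X^ a)) z) (*-congˡ (eval-* (X^ a) (θ ′ ∘ₚ X^ a) z))) ⟩
      (1# - w) * (- 1/ℕ f * (eval (X^ a) z * eval (θ ′ ∘ₚ X^ a) z))
        ≈⟨ *-congˡ (*-congˡ (*-cong (eval-X^ a z) (trans (eval-∘ (θ ′) (X^ a) z) (eval-at (θ ′) (eval-X^ a z))))) ⟩
      (1# - w) * (- 1/ℕ f * (w * eval (θ ′) w))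
        ≈⟨ solve 3 (λ w i e → (con (+ 1) :- w) :* (:- i :* e) := :- i :* ((con (+ 1) :- w) :* e)) refl w (1/ℕ f) (w * eval (θ ′) w) ⟩
      - 1/ℕ f * ((1# - w) * (w * eval (θ ′) w))
        ≈⟨ *-congˡ (eval-θ′ w f) ⟩
      - 1/ℕ f * (w * eval θ w - fromℕ f * w ^ f)
        ≈⟨ *-congˡ (+-cong (*-congˡ θ[w]≈0) (-‿cong (*-congˡ w^f≈1))) ⟩
      - 1/ℕ f * (w * 0# - fromℕ f * 1#)
        ≈⟨ solve 3 (λ i w n → :- i :* (w :* con (+ 0) :- n :* con (+ 1)) := n :* i) refl (1/ℕ f) w (fromℕ f) ⟩
      fromℕ f * 1/ℕ f
        ≈⟨ *-inv (fromℕ#0 f) ⟩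
      1# ∎
      where
      open ≈-Reasoning
      w = z ^ a
      eval-at : ∀ p {x y} → x ≈ y → eval p x ≈ eval p y
      eval-at []      x≈y = refl
      eval-at (c ∷ p) x≈y = +-congˡ (*-cong x≈y (eval-at p x≈y))
      w^f≈1 : w ^ f ≈ 1#
      w^f≈1 = trans (Exp.^-assocʳ z a f) (^[k*f]≈1 (isRoot ζ) a)
      θ[w]≈0 : eval θ w ≈ 0#
      θ[w]≈0 = #0⇒*≈0⇒≈0 (1-ζ^a#0 a f∤a)
        (trans (eval-θ w f) (trans (+-congˡ (-‿cong w^f≈1)) (-‿inverseʳ 1#)))

    -- 1 − ζᵃ eᵃˢ = (1 − ζᵃ) (1 − y (eᵃˢ − 1)) for y = ζᵃ/(1 − ζᵃ) = v(ζ) − 1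
    series-1/factor-∤ : ∀ a .{{_ : NonZero a}} → f ∤ a →
      series (1/ₗ (factor ζ a) (factor-hasOrder ζ a)) ≋
      eval (v a) z ·ₛ g[s, eval (v a) z - 1# ] ⟨ fromℕ a s⟩
    series-1/factor-∤ a f∤a = series-1/ₗ (factor ζ a) (factor-hasOrder ζ a) (factor-order-∤ f∤a) (begin
      (λ k → factor ζ a (k ℕ.+ 0)) ⊛ (V ·ₛ g[s, y ] ⟨ A s⟩)
        ≈⟨ 𝕊.*-congʳ ⟪ (λ k → trans (reflexive (≡.cong (factor ζ a) (ℕₚ.+-identityʳ k))) (step k)) ⟫ ⟩
      ((1# - w) ·ₛ (1ₛ -ₛ y ·ₛ expm1) ⟨ A s⟩) ⊛ (V ·ₛ g[s, y ] ⟨ A s⟩)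
        ≈⟨ ·ₛ-⊛-·ₛ (1# - w) ((1ₛ -ₛ y ·ₛ expm1) ⟨ A s⟩) V (g[s, y ] ⟨ A s⟩) ⟩
      ((1# - w) * V) ·ₛ ((1ₛ -ₛ y ·ₛ expm1) ⟨ A s⟩ ⊛ g[s, y ] ⟨ A s⟩)
        ≈⟨ ·ₛ-cong (v-inverse a f∤a) (⟨s⟩-inverse A (*-recip-⊛ (1ₛ -ₛ y ·ₛ expm1) _)) ⟩
      const 1#
        ≈⟨ const-1 ⟩
      1ₛ ∎)
      where
      open 𝕊.≋-Reasoning
      A = fromℕ a
      w = z ^ a
      V = eval (v a) z
      y = V - 1#
      [1-w]y≈w : (1# - w) * y ≈ w
      [1-w]y≈w = trans (solve 2 (λ w v → (con (+ 1) :- w) :* (v :- con (+ 1)) := (con (+ 1) :- w) :* v :- con (+ 1) :+ w) refl w V)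
        (trans (+-congʳ (trans (+-congʳ (v-inverse a f∤a)) (-‿inverseʳ 1#))) (+-identityˡ w))
      coefficient : ∀ {p o q} r → p * o ≈ o → q ≈ 1# → o - w * (p * r) ≈ (1# - w) * (p * (o - y * (q * r - o)))
      coefficient {p} {o} {q} r po≈o q≈1 = sym (
        trans (*-congˡ (*-congˡ (+-congˡ (-‿cong (*-congˡ (+-congʳ (*-congʳ q≈1)))))))
        (trans (solve 5 (λ w p o y r → (con (+ 1) :- w) :* (p :* (o :- y :* (con (+ 1) :* r :- o))) :=
                          (con (+ 1) :- w) :* (p :* o) :- ((con (+ 1) :- w) :* y) :* (p :* r :- p :* o)) refl w p o y r)
        (trans (+-cong (*-congˡ po≈o) (-‿cong (*-cong [1-w]y≈w (+-congˡ (-‿cong po≈o)))))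
               (solve 4 (λ w p o r → (con (+ 1) :- w) :* o :- w :* (p :* r :- o) := o :- w :* (p :* r)) refl w p o r))))
      step : ∀ k → factor ζ a k ≈ (1# - w) * (A ^ k * (1ₛ k - y * expm1 k))
      step k = coefficient _ (x^k*1ₛ A k) (1^ k)

  -- Residues of Laurent series

  shift-< : ∀ d F k → k ℕ.< d → shift d F k ≈ 0#
  shift-< (suc d) F zero    _           = refl
  shift-< (suc d) F (suc k) (ℕ.s≤s k<d) = shift-< d F k k<d

  shift-+ : ∀ d F k → shift d F (d ℕ.+ k) ≈ F k
  shift-+ zero    F k = refl
  shift-+ (suc d) F k = shift-+ d F k

  -- The pole orders of two summands need not agree: _+ₗ_ adds them and
  -- shifts both series.
  Res-+ₗ : ∀ L M → Res (L +ₗ M) ≈ Res L + Res M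
  Res-+ₗ (s^- zero  · F) (s^- zero  · G) = sym (+-identityʳ 0#)
  Res-+ₗ (s^- zero  · F) (s^- suc e · G) = +-congʳ (shift-< (suc e) F e ℕₚ.≤-refl)
  Res-+ₗ (s^- suc d · F) (s^- e     · G) = +-cong
    (trans (reflexive (≡.cong (shift e F) (ℕₚ.+-comm d e))) (shift-+ e F d)) (tail e)
    where
    tail : ∀ e → shift (suc d) G (d ℕ.+ e) ≈ Res (s^- e · G)
    tail zero    = shift-< (suc d) G (d ℕ.+ 0) (ℕ.s≤s (ℕₚ.≤-reflexive (ℕₚ.+-identityʳ d)))
    tail (suc e) = trans (reflexive (≡.cong (shift (suc d) G) (ℕₚ.+-suc d e))) (shift-+ d G e)

  Res-∑ₗ : ∀ {ℓ} {I : Set ℓ} (is : List I) (h : I → Laurent) →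
           Res (∑ₗ[ is ] h) ≈ ∑[ is ] (λ i → Res (h i))
  Res-∑ₗ []       h = refl
  Res-∑ₗ (i ∷ is) h = trans (Res-+ₗ (h i) (∑ₗ[ is ] h)) (+-congˡ (Res-∑ₗ is h))

  Res-pole : ∀ L k → pole L ≡ suc k → Res L ≈ series L k
  Res-pole (s^- suc d · F) .d ≡.refl = refl

  -- Reciprocals of natural numbers

  1/ℕ-unique : ∀ n .{{_ : NonZero n}} {x} → fromℕ n * x ≈ 1# → x ≈ 1/ℕ n
  1/ℕ-unique n nx≈1 = *-cancelˡ-# (fromℕ#0 n) (trans nx≈1 (sym (*-inv (fromℕ#0 n))))

  1/ℕ-* : ∀ m n .{{_ : NonZero m}} .{{_ : NonZero n}} .{{_ : NonZero (m ℕ.* n)}} →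
          1/ℕ m * 1/ℕ n ≈ 1/ℕ (m ℕ.* n)
  1/ℕ-* m n = 1/ℕ-unique (m ℕ.* n) (begin
    fromℕ (m ℕ.* n) * (1/ℕ m * 1/ℕ n)       ≈⟨ *-congʳ (Mult.×1-homo-* m n) ⟩
    fromℕ m * fromℕ n * (1/ℕ m * 1/ℕ n)     ≈⟨ solve 4 (λ m n i j → m :* n :* (i :* j) := m :* i :* (n :* j)) refl (fromℕ m) (fromℕ n) (1/ℕ m) (1/ℕ n) ⟩
    fromℕ m * 1/ℕ m * (fromℕ n * 1/ℕ n)     ≈⟨ *-cong (*-inv (fromℕ#0 m)) (*-inv (fromℕ#0 n)) ⟩
    1# * 1#                                 ≈⟨ *-identityˡ 1# ⟩
    1#                                      ∎)
    where open ≈-Reasoning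

  fromℤ-neg : ∀ t → fromℤ (ℤ.- t) ≈ - fromℤ t
  fromℤ-neg (+ zero)  = sym -0#≈0#
  fromℤ-neg (+ suc n) = refl
  fromℤ-neg -[1+ n ]  = solve 1 (λ x → x := :- (:- x)) refl (fromℕ (suc n))

  neg-^ : ∀ x k → (- x) ^ k ≈ (- 1#) ^ k * x ^ k
  neg-^ x k = trans (Exp.^-congˡ k (solve 1 (λ x → :- x := :- con (+ 1) :* x) refl x)) (CommExp.^-distrib-* (- 1#) x k)

  eval-applyUpTo : ∀ (h : ℕ → Carrier) e n y →
    eval (List.map h (List.applyUpTo e n)) y ≈ sum {n} (λ i → h (e (toℕ i)) * y ^ toℕ i)
  eval-applyUpTo h e zero    y = refl
  eval-applyUpTo h e (suc n) y = +-cong (sym (*-identityʳ _)) (begin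
    y * eval (List.map h (List.applyUpTo (e ∘ suc) n)) y
      ≈⟨ *-congˡ (eval-applyUpTo h (e ∘ suc) n y) ⟩
    y * sum {n} (λ i → h (e (suc (toℕ i))) * y ^ toℕ i)
      ≈⟨ *-distribˡ-sum {n} y _ ⟩
    sum {n} (λ i → y * (h (e (suc (toℕ i))) * y ^ toℕ i))
      ≈⟨ sum-cong-≋ {n} (λ i → solve 3 (λ y h p → y :* (h :* p) := h :* (y :* p)) refl y (h (e (suc (toℕ i)))) (y ^ toℕ i)) ⟩
    sum {n} (λ i → h (e (suc (toℕ i))) * y ^ suc (toℕ i)) ∎)
    where open ≈-Reasoning

  -- The Sylvester wave

  module WaveProperties {f : ℕ} .{{_ : NonTrivial f}} (𝒫 : PrimitiveRoots f)
                        {N : ℕ} (a : Vector ℕ N) (a>0 : ∀ i → NonZero (a i)) where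

    open Wave 𝒫 a a>0
    open CyclotomicProperties 𝒫

    -- The product of the vᵢ(ζ)
    ∏v : PrimitiveRoot f → Carrier
    ∏v ζ = ∏[ f∤a ] λ i → eval (v (a i)) (value ζ)

    -1/a : Fin N → Carrier
    -1/a i = - 1/ℕ (a i) {{a>0 i}}

    module _ (ζ : PrimitiveRoot f) where
      open FactorProperties 𝒫 ζ

      -- 1/(1 − ζ^aᵢ e^(aᵢ s))
      1/factor : Fin N → Laurent
      1/factor i = 1/ₗ (factor ζ (a i)) (factor-hasOrder ζ (a i) {{a>0 i}})

      private
        V : Fin N → Carrier
        V i = eval (v (a i)) (value ζ)

        G₁ G₂ : Fin N → Series
        G₁ i = g ⟨ fromℕ (a i) s⟩
        G₂ i = g[s, V i - 1# ] ⟨ fromℕ (a i) s⟩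

        f∣ f∤ : List (Fin N) → List (Fin N)
        f∣ = filter (λ i → f ∣? a i)
        f∤ = filter (λ i → ¬? (f ∣? a i))

        -- The product of the inverse factors over is, where js and ks are the
        -- indices i in is with f ∣ aᵢ and with f ∤ aᵢ.
        Expansion : (is js ks : List (Fin N)) → Set ℓ₁
        Expansion is js ks =
          pole (∏ₗ[ is ] 1/factor) ≡ length js ×
          series (∏ₗ[ is ] 1/factor) ≋ (∏[ js ] -1/a * ∏[ ks ] V) ·ₛ (∏ₛ[ js ] G₁ ⊛ ∏ₛ[ ks ] G₂)

        expansion : ∀ is → Expansion is (f∣ is) (f∤ is)
        expansion []       = ≡.refl , ⟪ (λ k → sym (trans
          (*-cong (*-identityˡ 1#) (at (𝕊.*-identityˡ 1ₛ) k)) (*-identityˡ _))) ⟫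
        expansion (i ∷ is) = step (f ∣? a i)
          where
          open 𝕊.≋-Reasoning
          Q = ∏ₛ[ f∣ is ] G₁
          R = ∏ₛ[ f∤ is ] G₂
          x = ∏[ f∣ is ] -1/a
          y = ∏[ f∤ is ] V
          split : ∀ {w F} → series (1/factor i) ≋ w ·ₛ F →
                  series (1/factor i) *ₛ series (∏ₗ[ is ] 1/factor) ≋ (w * (x * y)) ·ₛ (F ⊛ (Q ⊛ R))
          split {w} {F} eq = begin
            series (1/factor i) *ₛ series (∏ₗ[ is ] 1/factor)
              ≈⟨ *ₛ≋⊛ _ _ ⟩
            series (1/factor i) ⊛ series (∏ₗ[ is ] 1/factor)
              ≈⟨ 𝕊.*-cong eq (proj₂ (expansion is)) ⟩
            (w ·ₛ F) ⊛ ((x * y) ·ₛ (Q ⊛ R))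
              ≈⟨ ·ₛ-⊛-·ₛ w F (x * y) (Q ⊛ R) ⟩
            (w * (x * y)) ·ₛ (F ⊛ (Q ⊛ R)) ∎
          step : Dec (f ∣ a i) → Expansion (i ∷ is) (f∣ (i ∷ is)) (f∤ (i ∷ is))
          step (yes f∣aᵢ) = ≡.subst₂ (Expansion (i ∷ is))
            (≡.sym (filter-accept (λ i → f ∣? a i) f∣aᵢ))
            (≡.sym (filter-reject (λ i → ¬? (f ∣? a i)) (λ f∤aᵢ → f∤aᵢ f∣aᵢ)))
            ( ≡.cong₂ ℕ._+_ (factor-order-∣ f∣aᵢ) (proj₁ (expansion is))
            , 𝕊.trans (split (series-1/factor-∣ (a i) {{a>0 i}} f∣aᵢ))
                (·ₛ-cong (sym (*-assoc _ x y))
                  (𝕊.trans (𝕊.sym (𝕊.*-assoc (G₁ i) Q R)) (𝕊.*-congʳ (𝕊.sym (*ₛ≋⊛ (G₁ i) Q))))) )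
          step (no f∤aᵢ)  = ≡.subst₂ (Expansion (i ∷ is))
            (≡.sym (filter-reject (λ i → f ∣? a i) f∤aᵢ))
            (≡.sym (filter-accept (λ i → ¬? (f ∣? a i)) f∤aᵢ))
            ( ≡.cong₂ ℕ._+_ (factor-order-∤ f∤aᵢ) (proj₁ (expansion is))
            , 𝕊.trans (split (series-1/factor-∤ (a i) {{a>0 i}} f∤aᵢ))
                (·ₛ-cong (solve 3 (λ w x y → w :* (x :* y) := x :* (w :* y)) refl (V i) x y)
                  (𝕊.trans (𝕊.solve 3 (λ g q r → g 𝕊.:* (q 𝕊.:* r) 𝕊.:= q 𝕊.:* (g 𝕊.:* r)) 𝕊.refl (G₂ i) Q R)
                           (𝕊.*-congˡ (𝕊.sym (*ₛ≋⊛ (G₂ i) R))))) )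

      ∏ₗ-pole : pole (∏ₗ[ allFin N ] 1/factor) ≡ n
      ∏ₗ-pole = proj₁ (expansion (allFin N))

      ∏ₗ-series : series (∏ₗ[ allFin N ] 1/factor) ≋ (∏[ f∣a ] -1/a * ∏v ζ) ·ₛ gProduct ζ
      ∏ₗ-series = 𝕊.trans (proj₂ (expansion (allFin N)))
        (·ₛ-cong refl (𝕊.sym (*ₛ≋⊛ (∏ₛ[ f∣a ] G₁) (∏ₛ[ f∤a ] G₂))))

      -- The contribution of ζ to the wave, up to sign, for n = k + 1
      Res-term : ∀ t k → n ≡ suc k →
        Res (fromSeries (root^_ ζ (ℤ.- t) ·ₛ exp (fromℤ (ℤ.- t))) *ₗ ∏ₗ[ allFin N ] 1/factor) ≈
        sum {suc k} λ m → exp (fromℤ (ℤ.- t)) (toℕ m) * ∏[ f∣a ] -1/a * 𝒲 t ζ (k ℕ.∸ toℕ m)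
      Res-term t k n≡1+k = begin
        Res (fromSeries (r ·ₛ e) *ₗ ∏ₗ[ allFin N ] 1/factor)
          ≈⟨ Res-pole _ k (≡.trans ∏ₗ-pole n≡1+k) ⟩
        ((r ·ₛ e) *ₛ series (∏ₗ[ allFin N ] 1/factor)) k
          ≈⟨ *ₛ-cong {r ·ₛ e} (λ _ → refl) (at ∏ₗ-series) k ⟩
        ((r ·ₛ e) *ₛ ((κ * ∏v ζ) ·ₛ gProduct ζ)) k
          ≈⟨ sum-cong-≋ {suc k} (λ m → solve 5 (λ r e κ v g → r :* e :* (κ :* v :* g) := e :* κ :* (r :* v :* g)) refl
               r (e (toℕ m)) κ (∏v ζ) (gProduct ζ (k ℕ.∸ toℕ m))) ⟩
        (sum {suc k} λ m → e (toℕ m) * κ * 𝒲 t ζ (k ℕ.∸ toℕ m)) ∎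
        where
        open ≈-Reasoning
        r = root^_ ζ (ℤ.- t)
        e = exp (fromℤ (ℤ.- t))
        κ = ∏[ f∣a ] -1/a

    ∏-1/a : ∀ is .{{_ : NonZero (ℕ.product (List.map a is))}} →
            ∏[ is ] -1/a ≈ (- 1#) ^ length is * 1/ℕ (ℕ.product (List.map a is))
    ∏-1/a []       = sym (trans (*-identityˡ _) (1/1≈1 1 ≡.refl))
    ∏-1/a (i ∷ is) {{nz}} = begin
      -1/a i * ∏[ is ] -1/a
        ≈⟨ *-congˡ (∏-1/a is {{nz′}}) ⟩
      - 1/ℕ (a i) {{a>0 i}} * ((- 1#) ^ length is * 1/ℕ Π {{nz′}})
        ≈⟨ solve 3 (λ x s y → :- x :* (s :* y) := :- con (+ 1) :* s :* (x :* y)) refl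
             (1/ℕ (a i) {{a>0 i}}) ((- 1#) ^ length is) (1/ℕ Π {{nz′}}) ⟩
      (- 1#) ^ suc (length is) * (1/ℕ (a i) {{a>0 i}} * 1/ℕ Π {{nz′}})
        ≈⟨ *-congˡ (1/ℕ-* (a i) Π {{a>0 i}} {{nz′}} {{nz}}) ⟩
      (- 1#) ^ suc (length is) * 1/ℕ (a i ℕ.* Π) ∎
      where
      open ≈-Reasoning
      Π = ℕ.product (List.map a is)
      nz′ : NonZero Π
      nz′ = ℕₚ.m*n≢0⇒n≢0 (a i) {{nz}}

    module _ (M̂ : ℕ → List ℚ) (isM̂ : IsM̂ M̂) (c : ℕ → Fin f → Carrier)
             (c≡M : ∀ m → m ℕ.< n → M M̂ m *ₚ Φ̂ *ₚ Φ ′ ≡ₚ tabulate (c m) [mod X^ f −1 ]) where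

      -- The coefficient of s^(n−1−m), here for every integer t
      wave-coefficient : ∀ (t : ℤ) m → m ℕ.< n → ∀ (i : Fin f) → t ≡ + suc (toℕ i) [mod f ] →
        ∑[ roots ] (λ ζ → 𝒲 t ζ (n ℕ.∸ 1 ℕ.∸ m)) ≈ c m i
      wave-coefficient t m m<n i t≡i = begin
        ∑[ roots ] (λ ζ → 𝒲 t ζ k)
          ≈⟨ ∑-cong roots term ⟩
        ∑[ roots ] (λ ζ → eval (M M̂ m) (value ζ) * value⁻¹ ζ ^ suc (toℕ i))
          ≈⟨ coefficients-as-sums (M M̂ m) (c m) (c≡M m m<n) i ⟨
        c m i ∎
        where
        open ≈-Reasoning
        k = n ℕ.∸ 1 ℕ.∸ m
        p = List.map fromℚ (M̂ k)
        n>0 : NonZero n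
        n>0 = ℕ.>-nonZero (ℕₚ.≤-<-trans ℕ.z≤n m<n)
        k<n : k ℕ.< n
        k<n = ℕₚ.≤-<-trans (ℕₚ.m∸n≤m (n ℕ.∸ 1) m)
          (ℕₚ.≤-reflexive (ℕₚ.suc-pred n {{n>0}}))
        term : ∀ ζ → 𝒲 t ζ k ≈ eval (M M̂ m) (value ζ) * value⁻¹ ζ ^ suc (toℕ i)
        term ζ = begin
          root^_ ζ (ℤ.- t) * ∏v ζ * gProduct ζ k
            ≈⟨ *-cong (*-congʳ (root^-neg ζ t (suc (toℕ i)) t≡i)) (isM̂ ζ k k<n) ⟩
          value⁻¹ ζ ^ suc (toℕ i) * ∏v ζ * eval p (value ζ)
            ≈⟨ solve 3 (λ u v e → u :* v :* e := e :* v :* u) refl (value⁻¹ ζ ^ suc (toℕ i)) (∏v ζ) (eval p (value ζ)) ⟩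
          eval p (value ζ) * ∏v ζ * value⁻¹ ζ ^ suc (toℕ i)
            ≈⟨ *-congʳ (*-congˡ (eval-∏ f∤a (λ i → v (a i)) (value ζ))) ⟨
          eval p (value ζ) * eval (∏ₚ[ f∤a ] (λ i → v (a i))) (value ζ) * value⁻¹ ζ ^ suc (toℕ i)
            ≈⟨ *-congʳ (eval-* p (∏ₚ[ f∤a ] (λ i → v (a i))) (value ζ)) ⟨
          eval (p *ₚ ∏ₚ[ f∤a ] (λ i → v (a i))) (value ζ) * value⁻¹ ζ ^ suc (toℕ i)
            ≈⟨ *-congʳ (eval-⟨⟩R (p *ₚ ∏ₚ[ f∤a ] (λ i → v (a i))) ζ) ⟨
          eval (M M̂ m) (value ζ) * value⁻¹ ζ ^ suc (toℕ i) ∎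

      W-polynomial : ∀ k → n ≡ suc k → W ≐[ P c ]
      W-polynomial k n≡1+k t i t≡i = begin
        W t
          ≈⟨ -‿cong (Res-∑ₗ roots _) ⟩
        - ∑[ roots ] (λ ζ → Res (fromSeries (root^_ ζ (ℤ.- t) ·ₛ e) *ₗ ∏ₗ[ allFin N ] (1/factor ζ)))
          ≈⟨ -‿cong (∑-cong roots (λ ζ → Res-term ζ t k n≡1+k)) ⟩
        - ∑[ roots ] (λ ζ → sum {suc k} (h ζ))
          ≈⟨ -‿cong (∑-sum-comm roots (suc k) h) ⟩
        - sum {suc k} (λ m → ∑[ roots ] (λ ζ → h ζ m))
          ≈⟨ trans (sym (-1*x≈-x _)) (*-distribˡ-sum {suc k} (- 1#) (λ m → ∑[ roots ] (λ ζ → h ζ m))) ⟩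
        sum {suc k} (λ m → - 1# * ∑[ roots ] (λ ζ → h ζ m))
          ≈⟨ sum-cong-≋ {suc k} (λ m → term (toℕ m) (≡.subst (toℕ m ℕ.<_) (≡.sym n≡1+k) (Finₚ.toℕ<n m))) ⟩
        sum {suc k} (λ m → coefficient (toℕ m) * fromℤ t ^ toℕ m)
          ≈⟨ eval-applyUpTo coefficient (λ m → m) (suc k) (fromℤ t) ⟨
        eval (List.map coefficient (List.upTo (suc k))) (fromℤ t)
          ≡⟨ ≡.cong (λ j → eval (List.map coefficient (List.upTo j)) (fromℤ t)) n≡1+k ⟨
        eval (P c i) (fromℤ t) ∎
        where
        open ≈-Reasoning
        e = exp (fromℤ (ℤ.- t))
        κ = ∏[ f∣a ] -1/a
        h : PrimitiveRoot f → Fin (suc k) → Carrier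
        h ζ m = e (toℕ m) * κ * 𝒲 t ζ (k ℕ.∸ toℕ m)
        -- the coefficient of t^m in P c i
        coefficient : ℕ → Carrier
        coefficient m = (- 1#) ^ (n ℕ.+ m ℕ.+ 1) * 1/ℕ (m ℕ.! ℕ.* ∏a) {{m!∏a≢0 m}} * c m i
        term : ∀ m → m ℕ.< n →
          - 1# * ∑[ roots ] (λ ζ → e m * κ * 𝒲 t ζ (k ℕ.∸ m)) ≈ coefficient m * fromℤ t ^ m
        term m m<n = begin
          - 1# * ∑[ roots ] (λ ζ → e m * κ * 𝒲 t ζ (k ℕ.∸ m))
            ≈⟨ *-congˡ (*-distribˡ-∑ roots (e m * κ) _) ⟩
          - 1# * (e m * κ * ∑[ roots ] (λ ζ → 𝒲 t ζ (k ℕ.∸ m)))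
            ≈⟨ *-congˡ (*-congˡ wave) ⟩
          - 1# * (e m * κ * c m i)
            ≈⟨ *-congˡ (*-congʳ (*-cong (*-congʳ (trans (Exp.^-congˡ m (fromℤ-neg t)) (neg-^ (fromℤ t) m)))
                                        (∏-1/a f∣a {{∏a≢0}}))) ⟩
          - 1# * ((- 1#) ^ m * T * 1/m! * ((- 1#) ^ n * 1/∏a) * c m i)
            ≈⟨ solve 6 (λ s t x r y c → :- con (+ 1) :* (s :* t :* x :* (r :* y) :* c) :=
                          r :* s :* (:- con (+ 1) :* con (+ 1)) :* (x :* y) :* c :* t) refl
                 ((- 1#) ^ m) T 1/m! ((- 1#) ^ n) 1/∏a (c m i) ⟩
          (- 1#) ^ n * (- 1#) ^ m * (- 1#) ^ 1 * (1/m! * 1/∏a) * c m i * T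
            ≈⟨ *-congʳ (*-congʳ (*-cong (sym (trans (Exp.^-homo-* (- 1#) (n ℕ.+ m) 1) (*-congʳ (Exp.^-homo-* (- 1#) n m))))
                 (1/ℕ-* (m ℕ.!) ∏a {{m ℕₚ.!≢0}} {{∏a≢0}} {{m!∏a≢0 m}}))) ⟩
          coefficient m * T ∎
          where
          T = fromℤ t ^ m
          ∏a≢0 : NonZero ∏a
          ∏a≢0 = ℕₚ.m*n≢0⇒n≢0 (m ℕ.!) {{m!∏a≢0 m}}
          1/m! = 1/ℕ (m ℕ.!) {{m ℕₚ.!≢0}}
          1/∏a = 1/ℕ ∏a {{∏a≢0}}
          wave : ∑[ roots ] (λ ζ → 𝒲 t ζ (k ℕ.∸ m)) ≈ c m i
          wave = ≡.subst (λ j → ∑[ roots ] (λ ζ → 𝒲 t ζ (j ℕ.∸ 1 ℕ.∸ m)) ≈ c m i) n≡1+k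
            (wave-coefficient t m m<n i t≡i)

length-∈ : ∀ {ℓ} {A : Set ℓ} {x : A} {xs} → x ∈ xs → ∃ λ k → length xs ≡ suc k
length-∈ (here _)  = _ , ≡.refl
length-∈ (there _) = _ , ≡.refl

theorem2p8 : ∀ {c ℓ₁ ℓ₂} (K : HeytingField c ℓ₁ ℓ₂) (char0 : CharZero K) →
    let open Over K char0 in
    {N : ℕ} (a : Vector ℕ N) (a>0 : ∀ i → NonZero (a i)) → gcdᵥ a ≡ 1 →
    (f : ℕ) .{{_ : NonTrivial f}} → (∃ λ i → f ∣ a i) →
    PrimitiveRoot f → (𝒫 : PrimitiveRoots f) →
    let open Wave 𝒫 a a>0 in
    (M̂ : ℕ → List ℚ) → IsM̂ M̂ →
    (c : ℕ → Fin f → Carrier) →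
    (∀ m → m ℕ.< n → M M̂ m *ₚ Φ̂ *ₚ Φ ′ ≡ₚ tabulate (c m) [mod X^ f −1 ]) →
    (∀ (t : ℕ) m → m ℕ.< n → ∀ (i : Fin f) → + t ≡ + ℕ.suc (toℕ i) [mod f ] →
    (∑ₛ[ roots ] λ ζ → 𝒲 (+ t) ζ) (n ℕ.∸ 1 ℕ.∸ m) ≈ c m i)
    × (W ≐[ P c ])
theorem2p8 K char0 {N} a a>0 _ f (i₀ , f∣aᵢ₀) _ 𝒫 M̂ isM̂ c c≡M =
    (λ t m m<n i t≡i → trans (∑ₛ-at roots (𝒲 (+ t)) (n ℕ.∸ 1 ℕ.∸ m))
                             (wave-coefficient M̂ isM̂ c c≡M (+ t) m m<n i t≡i))
  , W-polynomial M̂ isM̂ c c≡M (proj₁ nonempty) (proj₂ nonempty)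
  where
  open Over K char0
  open OverField K char0
  open Wave 𝒫 a a>0
  open WaveProperties 𝒫 a a>0
  open HeytingField K using (trans)
  -- some aᵢ is divisible by f, so that n > 0
  nonempty : ∃ λ k → n ≡ suc k
  nonempty = length-∈ (∈-filter⁺ (λ i → f ∣? a i) (∈-allFin i₀) f∣aᵢ₀)
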